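{- Let $s,t$ be integers with $s=2^as'$ and $t=2^bt'$, where $a,b$ are positive integers, $s',t'$ are integers with $2\nmid s't'$, and $b=2a-1$. Let $(P_n)_{n\ge1}$ be the sequence of Lucas atoms associated with $(s,t)$. Then for each $n\ge 2$, \[ v_2(P_n)=\begin{cases} a & \text{if } n=2,\\ b+1+v_2(s'^2+t') & \text{if } n=4,\\ 2^{h-2}b+1 & \text{if } n=2^h \text{ for some integer } h\ge 3,\\ b\,\dfrac{\varphi(n)}{2} & \text{otherwise.}\end{cases} \]
   Context: Lucas atoms: for $n\ge 1$ let $\Phi_n(\alpha,\beta)=\prod_{1\le j\le n,\ \gcd(j,n)=1}(\alpha-\omega^j\beta)$, with $\omega$ a primitive $n$-th root of unity (the homogenization of the $n$-th cyclotomic polynomial). Put $P_1(s,t)=1$, and for $n\ge 2$ let $P_n(s,t)\in\mathbb Z[s,t]$ be the unique polynomial with $P_n(\alpha+\beta,-\alpha\beta)=\Phi_n(\alpha,\beta)$ as polynomials in the variables $\alpha,\beta$. For integers $s,t$, $P_n$ denotes the integer value $P_n(s,t)$. $v_2$ is the $2$-adic valuation, with $v_2(0)=+\infty$; $\varphi$ is Euler's totient function. -}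

module Defs where

open import Algebra.Apartness.Bundles using (HeytingField; module HeytingCommutativeRing)
open import Algebra.Bundles using (CommutativeRing)
open import Algebra.Bundles.Raw using (RawRing)
import Algebra.Definitions.RawSemiring as RawSemiringDefs
open import Data.Integer.Base as ℤ using (ℤ; +_; -[1+_])
open import Data.List.Base using (List; []; _∷_; map; filter; foldr; length; upTo)
open import Data.Nat.Base as ℕ using (ℕ; zero; suc; _≤_; _<_)
open import Data.Nat.Divisibility using (_∣?_)
open import Data.Nat.GCD using (gcd)
open import Data.Nat.Properties using (_≟_)
open import Data.Product.Base using (_×_)
open import Level using (Level; _⊔_)
open import Relation.Nullary.Construct.Add.Supremum using (_⁺; ⊤⁺; [_])
open import Relation.Nullary.Negation using (¬_)

private
  variable
    c ℓ ℓ₁ ℓ₂ : Level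

------------------------------------------------------------------------
-- Polynomials

-- R[X]: coefficient lists, constant term first.  Trailing zeros are
-- allowed, and equality is equality of all coefficients.
module Polynomial (R : RawRing c ℓ) where
  open RawRing R

  coeff : List Carrier → ℕ → Carrier
  coeff []      _       = 0#
  coeff (a ∷ _) zero    = a
  coeff (_ ∷ p) (suc i) = coeff p i

  add : List Carrier → List Carrier → List Carrier
  add []      q       = q
  add (a ∷ p) []      = a ∷ p
  add (a ∷ p) (b ∷ q) = (a + b) ∷ add p q

  mul : List Carrier → List Carrier → List Carrier
  mul []      q = []
  mul (a ∷ p) q = add (map (a *_) q) (0# ∷ mul p q)

  rawRing : RawRing c ℓ
  rawRing = record
    { Carrier = List Carrier
    ; _≈_     = λ p q → ∀ i → coeff p i ≈ coeff q i
    ; _+_     = add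
    ; _*_     = mul
    ; -_      = map (-_)
    ; 0#      = []
    ; 1#      = 1# ∷ []
    }

  constant : Carrier → List Carrier
  constant a = a ∷ []

  X : List Carrier
  X = 0# ∷ 1# ∷ []

infix 9 _[X]
_[X] : RawRing c ℓ → RawRing c ℓ
R [X] = Polynomial.rawRing R

ℤ-rawRing : RawRing _ _
ℤ-rawRing = ℤ.+-*-rawRing

-- ℤ[s,t] is ℤ[s][t]: the outer variable is t.
ℤ[s,t] : RawRing _ _
ℤ[s,t] = ℤ-rawRing [X] [X]

module Evaluation (R : RawRing c ℓ) where
  open RawRing R
  open RawSemiringDefs rawSemiring using () renaming (_×_ to _·_)

  fromℤ : ℤ → Carrier
  fromℤ (+ n)    = n · 1#
  fromℤ -[1+ n ] = - (suc n · 1#)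

  horner : {A : Set} → (A → Carrier) → List A → Carrier → Carrier
  horner f []      x = 0#
  horner f (a ∷ p) x = f a + x * horner f p x

  eval : RawRing.Carrier ℤ[s,t] → Carrier → Carrier → Carrier
  eval p s t = horner (λ q → horner fromℤ q s) p t

------------------------------------------------------------------------
-- Arithmetic functions

coprimes : ℕ → List ℕ
coprimes n = filter (λ j → gcd j n ≟ 1) (map suc (upTo n))

φ : ℕ → ℕ
φ n = length (coprimes n)

-- For m > 0 the bound k < m loses nothing, as 2 ^ k ∣ m forces k < m.
v₂ℕ : ℕ → ℕ ⁺
v₂ℕ zero      = ⊤⁺
v₂ℕ m@(suc _) = [ foldr ℕ._⊔_ 0 (filter (λ k → 2 ℕ.^ k ∣? m) (upTo m)) ]

v₂ : ℤ → ℕ ⁺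
v₂ z = v₂ℕ ℤ.∣ z ∣

infixr 6 _+⁺_
_+⁺_ : ℕ → ℕ ⁺ → ℕ ⁺
m +⁺ ⊤⁺    = ⊤⁺
m +⁺ [ n ] = [ m ℕ.+ n ]

------------------------------------------------------------------------
-- Lucas atoms

-- Any field of characteristic 0 containing primitive roots of unity of
-- all orders, such as ℂ, can play the role of K.
module _ (K : HeytingField c ℓ₁ ℓ₂) where
  open HeytingField K using (Carrier; _≈_; 0#; 1#; heytingCommutativeRing)

  fieldRawRing : RawRing c ℓ₁
  fieldRawRing = CommutativeRing.rawRing
    (HeytingCommutativeRing.commutativeRing heytingCommutativeRing)

  open RawSemiringDefs (RawRing.rawSemiring fieldRawRing)
    using (_^_) renaming (_×_ to _·_)

  CharacteristicZero : Set ℓ₁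
  CharacteristicZero = ∀ n → 0 < n → ¬ (n · 1# ≈ 0#)

  IsPrimitiveRoot : ℕ → Carrier → Set ℓ₁
  IsPrimitiveRoot n ω = ω ^ n ≈ 1# × (∀ k → 0 < k → k < n → ¬ (ω ^ k ≈ 1#))

  K[α,β] : RawRing c ℓ₁
  K[α,β] = fieldRawRing [X] [X]

  private
    module K[α]   = Polynomial fieldRawRing
    module K[α][β] = Polynomial (fieldRawRing [X])

  open RawRing K[α,β] using () renaming
    (Carrier to Poly; _≈_ to _≋_; _+_ to _⊕_; _*_ to _⊗_; -_ to ⊖_; 1# to 𝟙)

  α β : Poly
  α = K[α][β].constant K[α].X
  β = K[α][β].X

  scalar : Carrier → Poly
  scalar a = K[α][β].constant (K[α].constant a)

  Φ : ℕ → Carrier → Poly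
  Φ n ω = foldr _⊗_ 𝟙
    (map (λ j → α ⊕ ⊖ (scalar (ω ^ j) ⊗ β)) (coprimes n))

  -- P is the sequence of Lucas atoms, where ω n is the primitive n-th
  -- root of unity used to form Φₙ.  The value P 0 is irrelevant.
  record IsLucasAtoms (ω : ℕ → Carrier)
                      (P : ℕ → RawRing.Carrier ℤ[s,t]) : Set ℓ₁ where
    field
      P₁ : RawRing._≈_ ℤ[s,t] (P 1) (RawRing.1# ℤ[s,t])
      Pₙ : ∀ n → 2 ≤ n →
           Evaluation.eval K[α,β] (P n) (α ⊕ β) (⊖ (α ⊗ β)) ≋ Φ n (ω n)

value : RawRing.Carrier ℤ[s,t] → ℤ → ℤ → ℤ
value = Evaluation.eval ℤ-rawRing

{-# OPTIONS --safe #-}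

-- Write Pₙ = Pₙ(s, t) and let α + β = s, αβ = -t.
--
-- If n = 2ʰ, then Φₙ(α, β) = α^(n/2) + β^(n/2), so the atoms satisfy P₂ = s and
-- P₂ₙ = Pₙ² - 2(αβ)^(n/2); the valuations follow by induction.
--
-- Otherwise n has an odd divisor m > 1.  Then every 1 - ωʲ with j prime to n divides m in
-- ℤ[ω], so Pₙ(2, -1) = Φₙ(1, 1) divides an odd integer in ℤ[ω]; by Nakayama's lemma ½ ∉ ℤ[ω],
-- so Pₙ(2, -1) is odd.  Put r = √2 and ρ = 2ᵃ⁻¹r.  Then ρ² = 2ᵇ, s = ρ·rs′ and t = ρ²t′, whence
-- Pₙ(s, t) = ρ^φ(n) Pₙ(rs′, t′) by homogeneity.  Since rs′ ≡ 0 ≡ 2 and t′ ≡ -1 modulo r,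
-- Pₙ(rs′, t′) = A + Br with A ≡ Pₙ(2, -1) odd.  Comparing coefficients of 1 and r shows that
-- φ(n) is even and Pₙ(s, t) = 2^(bφ(n)/2) A.
module Submission where

open import Defs
open import Algebra.Apartness.Bundles using (HeytingField; module HeytingCommutativeRing)
open import Algebra.Bundles using (CommutativeRing)
open import Algebra.Bundles.Raw using (RawRing)
import Algebra.Definitions.RawSemiring as RawSemiringDefs
open import Algebra.Morphism.Construct.Composition using (isRingHomomorphism)
open import Algebra.Morphism.Structures using (module RingMorphisms)
import Algebra.Properties.CommutativeSemiring.Exp as CommutativeSemiringExp
import Algebra.Properties.Ring as RingProperties
import Algebra.Properties.Semiring.Exp as SemiringExp
import Algebra.Properties.Semiring.Mult as SemiringMult
import Algebra.Solver.Ring as RingSolver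
import Algebra.Solver.Ring.AlmostCommutativeRing as ACR
open import Data.Empty using (⊥-elim)
open import Data.Integer.Base as ℤ using (ℤ; +_; -[1+_])
import Data.Integer.DivMod as ℤ
open import Data.Integer.Divisibility.Signed as Signed using (∣ᵤ⇒∣)
import Data.Integer.Properties as ℤ
import Data.Integer.Tactic.RingSolver as ℤ-Solver
open import Data.List.Base using (List; []; _∷_; map; foldr; applyUpTo; upTo; filter; length)
open import Data.List.Membership.Propositional using (_∈_)
open import Data.List.Membership.Propositional.Properties using (∈-upTo⁺; ∈-filter⁺)
import Data.List.Properties as List
open import Data.List.Relation.Unary.All as All using (All; []; _∷_)
import Data.List.Relation.Unary.All.Properties as All
open import Data.List.Relation.Unary.Any using (Any; here; there)
import Data.List.Relation.Unary.Any.Properties as Any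
open import Data.Maybe.Base as Maybe using (Maybe)
open import Data.Nat.Base as ℕ using (ℕ; zero; suc; _≤_; _<_; z≤n; s≤s; NonZero; _⊔_)
open import Data.Nat.Coprimality using (Coprime; coprime-divisor)
open import Data.Nat.Divisibility as ℕ using (divides; _∣?_)
import Data.Nat.DivMod as ℕ
open import Data.Nat.GCD using (gcd; gcd-greatest; gcd[m,n]∣m; gcd[m,n]∣n)
open import Data.Nat.Induction using (<-rec)
import Data.Nat.Properties as ℕ
import Data.Nat.Tactic.RingSolver as ℕ-Solver
open import Data.Product.Base using (_×_; _,_; proj₁; proj₂; ∃; ∃₂)
open import Data.Sum.Base using (_⊎_; inj₁; inj₂)
open import Function.Base using (_∘_; id)
open import Level using (Level; 0ℓ)
open import Relation.Binary.Core using (REL)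
open import Relation.Binary.PropositionalEquality as ≡ using (_≡_; _≢_)
import Relation.Binary.Reasoning.Setoid as ≈-Reasoning
open import Relation.Nullary.Construct.Add.Supremum using (⊤⁺; [_])
open import Relation.Nullary.Decidable.Core using (yes; no; dec⇒maybe)
open import Relation.Nullary.Negation using (¬_)
open import Relation.Unary using (Pred; Decidable)
open RingMorphisms using (IsRingHomomorphism)

-- A half-integral exponent is the obstacle. In the grading with s of weight 1 and t of weight 2,
-- the scale fixed by t is 2^(b/2) = 2^(a-1)√2, and s exceeds it by a factor √2 only. After division
-- by that scale just the residues modulo √2 matter, and among the points with those residues (2,
-- -1) is convenient, because α = β = 1 there. `K` already contains a √2, namely ζ + ζ⁻¹ for ζ a
-- primitive eighth root of unity, but comparing coefficients in `K` would require its
-- irrationality. A formal square root r makes 1 and r independent by construction. Likewise α and β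
-- are adjoined formally, as X² - sX - t may fail to split in `K`. These extensions may have zero
-- divisors; no nonzero factor is ever cancelled in them. Nakayama's lemma stands in for a prime of
-- ℤ[ω] above 2: it works with the generators ωⁱ, without a basis, and its outcome is an odd integer
-- equal to 0 in `K`, against characteristic 0.

private variable
  c ℓ c₁ ℓ₁ c₂ ℓ₂ ℓ₃ : Level

-- Ring homomorphisms and the image of ℤ in a commutative ring.

module _ (A : RawRing c₁ ℓ₁) (B : RawRing c₂ ℓ₂) where
  private
    module A = RawRing A
    module B = RawRing B

  mkRingHom : {f : A.Carrier → B.Carrier} →
    (∀ {x y} → x A.≈ y → f x B.≈ f y) →
    (∀ x y → f (x A.+ y) B.≈ f x B.+ f y) →
    (∀ x y → f (x A.* y) B.≈ f x B.* f y) →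
    (∀ x → f (A.- x) B.≈ B.- f x) →
    f A.0# B.≈ B.0# → f A.1# B.≈ B.1# →
    IsRingHomomorphism A B f
  mkRingHom cong +-homo *-homo -‿homo 0#-homo 1#-homo = record
    { isSemiringHomomorphism = record
      { isNearSemiringHomomorphism = record
        { +-isMonoidHomomorphism = record
          { isMagmaHomomorphism = record
            { isRelHomomorphism = record { cong = cong } ; homo = +-homo }
          ; ε-homo = 0#-homo }
        ; *-homo = *-homo }
      ; 1#-homo = 1#-homo }
    ; -‿homo = -‿homo }

module IntegerEmbedding (R : CommutativeRing c ℓ) where
  open CommutativeRing R hiding (zero)
  open Evaluation rawRing using (fromℤ) public
  open RingProperties ring using (-‿+-comm; -0#≈0#; -‿involutive; -‿distribˡ-*)
  open SemiringMult semiring using (×-homo-+) renaming (_×_ to _·_)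
  open ≈-Reasoning setoid

  fromℤ-⊖ : ∀ m n → fromℤ (m ℤ.⊖ n) ≈ m · 1# - n · 1#
  fromℤ-⊖ m       zero    = sym (trans (+-congˡ -0#≈0#) (+-identityʳ _))
  fromℤ-⊖ zero    (suc n) = sym (+-identityˡ _)
  fromℤ-⊖ (suc m) (suc n) = begin
    fromℤ (suc m ℤ.⊖ suc n)               ≡⟨ ≡.cong fromℤ (ℤ.[1+m]⊖[1+n]≡m⊖n m n) ⟩
    fromℤ (m ℤ.⊖ n)                       ≈⟨ fromℤ-⊖ m n ⟩
    m · 1# - n · 1#                       ≈⟨ +-congʳ (+-identityʳ _) ⟨
    m · 1# + 0# - n · 1#                  ≈⟨ +-congʳ (+-congˡ (-‿inverseʳ 1#)) ⟨
    m · 1# + (1# - 1#) - n · 1#           ≈⟨ +-congʳ (+-assoc _ _ _) ⟨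
    m · 1# + 1# - 1# - n · 1#             ≈⟨ +-congʳ (+-congʳ (+-comm _ _)) ⟩
    suc m · 1# - 1# - n · 1#              ≈⟨ +-assoc _ _ _ ⟩
    suc m · 1# + (- 1# - n · 1#)          ≈⟨ +-congˡ (-‿+-comm _ _) ⟩
    suc m · 1# - suc n · 1#               ∎

  fromℤ-+ : ∀ x y → fromℤ (x ℤ.+ y) ≈ fromℤ x + fromℤ y
  fromℤ-+ (+ m)    (+ n)    = ×-homo-+ 1# m n
  fromℤ-+ (+ m)    -[1+ n ] = fromℤ-⊖ m (suc n)
  fromℤ-+ -[1+ m ] (+ n)    = trans (fromℤ-⊖ n (suc m)) (+-comm _ _)
  fromℤ-+ -[1+ m ] -[1+ n ] = begin
    - (suc (suc (m ℕ.+ n)) · 1#)       ≡⟨ ≡.cong (λ k → - (suc k · 1#)) (≡.sym (ℕ.+-suc m n)) ⟩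
    - ((suc m ℕ.+ suc n) · 1#)         ≈⟨ -‿cong (×-homo-+ 1# (suc m) (suc n)) ⟩
    - (suc m · 1# + suc n · 1#)        ≈⟨ -‿+-comm _ _ ⟨
    - (suc m · 1#) - suc n · 1#        ∎

  fromℤ-neg : ∀ x → fromℤ (ℤ.- x) ≈ - fromℤ x
  fromℤ-neg (+ zero)  = sym -0#≈0#
  fromℤ-neg (+ suc n) = refl
  fromℤ-neg -[1+ n ]  = sym (-‿involutive _)

  fromℤ-+* : ∀ m y → fromℤ (+ m ℤ.* y) ≈ m · 1# * fromℤ y
  fromℤ-+* zero    y = sym (zeroˡ _)
  fromℤ-+* (suc m) y = begin
    fromℤ (+ suc m ℤ.* y)               ≡⟨ ≡.cong fromℤ (ℤ.suc-* (+ m) y) ⟩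
    fromℤ (y ℤ.+ + m ℤ.* y)             ≈⟨ fromℤ-+ y (+ m ℤ.* y) ⟩
    fromℤ y + fromℤ (+ m ℤ.* y)         ≈⟨ +-cong (sym (*-identityˡ _)) (fromℤ-+* m y) ⟩
    1# * fromℤ y + m · 1# * fromℤ y     ≈⟨ distribʳ _ _ _ ⟨
    suc m · 1# * fromℤ y                ∎

  fromℤ-* : ∀ x y → fromℤ (x ℤ.* y) ≈ fromℤ x * fromℤ y
  fromℤ-* (+ m)    y = fromℤ-+* m y
  fromℤ-* -[1+ m ] y = begin
    fromℤ (-[1+ m ] ℤ.* y)           ≡⟨ ≡.cong fromℤ (≡.sym (ℤ.neg-distribˡ-* (+ suc m) y)) ⟩
    fromℤ (ℤ.- (+ suc m ℤ.* y))      ≈⟨ fromℤ-neg (+ suc m ℤ.* y) ⟩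
    - fromℤ (+ suc m ℤ.* y)          ≈⟨ -‿cong (fromℤ-+* (suc m) y) ⟩
    - (suc m · 1# * fromℤ y)         ≈⟨ -‿distribˡ-* _ _ ⟩
    fromℤ -[1+ m ] * fromℤ y         ∎

  fromℤ-isRingHomomorphism : IsRingHomomorphism ℤ-rawRing rawRing fromℤ
  fromℤ-isRingHomomorphism = mkRingHom ℤ-rawRing rawRing
    (λ where ≡.refl → refl) fromℤ-+ fromℤ-* fromℤ-neg refl (+-identityʳ _)

-- Coefficients are taken in ℤ, where equality is decidable even if `_≈_` of `R` is not. Since
-- `con (+ 1)` evaluates to `1# + 0#`, identities that involve `1#` pass it as a variable, usually
-- called `e`.
module IntegerSolver (R : CommutativeRing c ℓ) where
  open CommutativeRing R using (_≈_; refl; +-identityʳ; 1#)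
  open IntegerEmbedding R
  private
    almostCommutativeRing : ACR.AlmostCommutativeRing _ _
    almostCommutativeRing = ACR.fromCommutativeRing R

    fromℤ-morphism : ℤ-rawRing ACR.-Raw-AlmostCommutative⟶ almostCommutativeRing
    fromℤ-morphism = record
      { ⟦_⟧ = fromℤ ; +-homo = fromℤ-+ ; *-homo = fromℤ-* ; -‿homo = fromℤ-neg
      ; 0-homo = refl ; 1-homo = +-identityʳ 1# }

    fromℤ-≟ : ∀ x y → Maybe (fromℤ x ≈ fromℤ y)
    fromℤ-≟ x y = Maybe.map (λ where ≡.refl → refl) (dec⇒maybe (x ℤ.≟ y))

  open RingSolver ℤ-rawRing almostCommutativeRing fromℤ-morphism fromℤ-≟
    using (solve; _:=_; _:+_; _:*_; _:-_; :-_; con) public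

-- Evaluation of integer polynomials and substitution into polynomials.

module _ (A : RawRing c₁ ℓ₁) (B : RawRing c₂ ℓ₂) where
  private
    module A = RawRing A
    module B = RawRing B
    module EA = Evaluation A
    module EB = Evaluation B

  -- A relation closed under the ring operations is inherited by values of integer polynomials. It
  -- is instantiated with equality, with the graph of a homomorphism, and with reduction modulo √2,
  -- which is not given as a function.
  record Compatible (_~_ : REL A.Carrier B.Carrier ℓ₃) : Set (c₁ Level.⊔ c₂ Level.⊔ ℓ₃) where
    field
      0~ : A.0# ~ B.0#
      1~ : A.1# ~ B.1#
      +~ : ∀ {x x′ y y′} → x ~ x′ → y ~ y′ → (x A.+ y) ~ (x′ B.+ y′)
      *~ : ∀ {x x′ y y′} → x ~ x′ → y ~ y′ → (x A.* y) ~ (x′ B.* y′)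
      -~ : ∀ {x x′} → x ~ x′ → (A.- x) ~ (B.- x′)

    fromℕ~ : ∀ n → EA.fromℤ (+ n) ~ EB.fromℤ (+ n)
    fromℕ~ zero    = 0~
    fromℕ~ (suc n) = +~ 1~ (fromℕ~ n)

    fromℤ~ : ∀ z → EA.fromℤ z ~ EB.fromℤ z
    fromℤ~ (+ n)    = fromℕ~ n
    fromℤ~ -[1+ n ] = -~ (fromℕ~ (suc n))

    horner~ : ∀ {C : Set} {f : C → A.Carrier} {g : C → B.Carrier} {x y} →
              (∀ a → f a ~ g a) → x ~ y → ∀ p → EA.horner f p x ~ EB.horner g p y
    horner~ f~g x~y []      = 0~
    horner~ f~g x~y (a ∷ p) = +~ (f~g a) (*~ x~y (horner~ f~g x~y p))

    eval~ : ∀ {s t s′ t′} → s ~ s′ → t ~ t′ →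
            ∀ p → EA.eval p s t ~ EB.eval p s′ t′
    eval~ s~s′ t~t′ = horner~ (horner~ fromℤ~ s~s′) t~t′

module _ (A : RawRing c₁ ℓ₁) (R : CommutativeRing c ℓ)
         {f : RawRing.Carrier A → CommutativeRing.Carrier R}
         (f-hom : IsRingHomomorphism A (CommutativeRing.rawRing R) f) where
  private module A = RawRing A
  open CommutativeRing R hiding (zero)
  open IntegerSolver R using (solve; _:=_; _:+_; _:*_; _:-_; :-_)
  open RingProperties ring using (-0#≈0#)
  open IsRingHomomorphism f-hom
  open ≈-Reasoning setoid

  -- A record, so that x can be inferred from x ↦ y.
  infix 4 _↦_
  record _↦_ (x : A.Carrier) (y : Carrier) : Set ℓ where
    constructor ↦-intro
    field
      ↦-elim : f x ≈ y
  open _↦_ public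

  ↦-compatible : Compatible A rawRing _↦_
  ↦-compatible = record
    { 0~ = ↦-intro 0#-homo
    ; 1~ = ↦-intro 1#-homo
    ; +~ = λ (↦-intro x~) (↦-intro y~) → ↦-intro (trans (+-homo _ _) (+-cong x~ y~))
    ; *~ = λ (↦-intro x~) (↦-intro y~) → ↦-intro (trans (*-homo _ _) (*-cong x~ y~))
    ; -~ = λ (↦-intro x~) → ↦-intro (trans (-‿homo _) (-‿cong x~))
    }

  -- `A` is a raw ring because the construction is iterated: for two variables `A` becomes `K[X]`,
  -- whose ring laws are never established.
  module Substitution (x : Carrier) where
    open Polynomial A hiding (rawRing)

    ev : List A.Carrier → Carrier
    ev []      = 0#
    ev (a ∷ p) = f a + x * ev p

    ev-zero : ∀ p → (∀ i → A._≈_ (coeff p i) A.0#) → ev p ≈ 0#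
    ev-zero []      p≈0 = refl
    ev-zero (a ∷ p) p≈0 = begin
      f a + x * ev p  ≈⟨ +-cong (trans (⟦⟧-cong (p≈0 0)) 0#-homo)
                                (*-congˡ (ev-zero p (λ i → p≈0 (suc i)))) ⟩
      0# + x * 0#     ≈⟨ trans (+-identityˡ _) (zeroʳ x) ⟩
      0#              ∎

    -- The mirror image of `ev-zero`: equality in a raw ring cannot be reversed, and `ev-cong` meets
    -- a list that ends early on either side.
    ev-zero′ : ∀ p → (∀ i → A._≈_ A.0# (coeff p i)) → ev p ≈ 0#
    ev-zero′ []      p≈0 = refl
    ev-zero′ (a ∷ p) p≈0 = begin
      f a + x * ev p  ≈⟨ +-cong (trans (sym (⟦⟧-cong (p≈0 0))) 0#-homo)
                                (*-congˡ (ev-zero′ p (λ i → p≈0 (suc i)))) ⟩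
      0# + x * 0#     ≈⟨ trans (+-identityˡ _) (zeroʳ x) ⟩
      0#              ∎

    ev-cong : ∀ p q → (∀ i → A._≈_ (coeff p i) (coeff q i)) → ev p ≈ ev q
    ev-cong []      q       p≈q = sym (ev-zero′ q p≈q)
    ev-cong (a ∷ p) []      p≈q = ev-zero (a ∷ p) p≈q
    ev-cong (a ∷ p) (b ∷ q) p≈q =
      +-cong (⟦⟧-cong (p≈q 0)) (*-congˡ (ev-cong p q (λ i → p≈q (suc i))))

    ev-add : ∀ p q → ev (add p q) ≈ ev p + ev q
    ev-add []      q       = sym (+-identityˡ _)
    ev-add (a ∷ p) []      = sym (+-identityʳ _)
    ev-add (a ∷ p) (b ∷ q) = begin
      f (a A.+ b) + x * ev (add p q)       ≈⟨ +-cong (+-homo a b) (*-congˡ (ev-add p q)) ⟩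
      f a + f b + x * (ev p + ev q)        ≈⟨ solve 5 (λ a b x p q →
        a :+ b :+ x :* (p :+ q) := (a :+ x :* p) :+ (b :+ x :* q)) refl (f a) (f b) x (ev p) (ev q) ⟩
      (f a + x * ev p) + (f b + x * ev q)  ∎

    ev-scale : ∀ a p → ev (map (a A.*_) p) ≈ f a * ev p
    ev-scale a []      = sym (zeroʳ _)
    ev-scale a (b ∷ p) = begin
      f (a A.* b) + x * ev (map (a A.*_) p)  ≈⟨ +-cong (*-homo a b) (*-congˡ (ev-scale a p)) ⟩
      f a * f b + x * (f a * ev p)           ≈⟨ solve 4 (λ a b x p →
        a :* b :+ x :* (a :* p) := a :* (b :+ x :* p)) refl (f a) (f b) x (ev p) ⟩
      f a * (f b + x * ev p)                 ∎

    ev-mul : ∀ p q → ev (mul p q) ≈ ev p * ev q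
    ev-mul []      q = sym (zeroˡ _)
    ev-mul (a ∷ p) q = begin
      ev (add (map (a A.*_) q) (A.0# ∷ mul p q))   ≈⟨ ev-add (map (a A.*_) q) _ ⟩
      ev (map (a A.*_) q) + (f A.0# + x * ev (mul p q))
        ≈⟨ +-cong (ev-scale a q) (trans (+-congʳ 0#-homo) (trans (+-identityˡ _) (*-congˡ (ev-mul p q)))) ⟩
      f a * ev q + x * (ev p * ev q)               ≈⟨ solve 4 (λ a x p q →
        a :* q :+ x :* (p :* q) := (a :+ x :* p) :* q) refl (f a) x (ev p) (ev q) ⟩
      (f a + x * ev p) * ev q                      ∎

    ev-neg : ∀ p → ev (map A.-_ p) ≈ - ev p
    ev-neg []      = sym -0#≈0#
    ev-neg (a ∷ p) = begin
      f (A.- a) + x * ev (map A.-_ p)  ≈⟨ +-cong (-‿homo a) (*-congˡ (ev-neg p)) ⟩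
      - f a + x * - ev p               ≈⟨ solve 3 (λ a x p →
        :- a :+ x :* (:- p) := :- (a :+ x :* p)) refl (f a) x (ev p) ⟩
      - (f a + x * ev p)               ∎

    ev-constant : ∀ a → ev (constant a) ≈ f a
    ev-constant a = trans (+-congˡ (zeroʳ x)) (+-identityʳ (f a))

    ev-X : ev X ≈ x
    ev-X = begin
      f A.0# + x * (f A.1# + x * 0#)  ≈⟨ +-cong 0#-homo (*-congˡ (+-cong 1#-homo (zeroʳ x))) ⟩
      0# + x * (1# + 0#)
        ≈⟨ trans (+-identityˡ _) (trans (*-congˡ (+-identityʳ 1#)) (*-identityʳ x)) ⟩
      x                               ∎

    ev-isRingHomomorphism : IsRingHomomorphism (A [X]) rawRing ev
    ev-isRingHomomorphism = mkRingHom (A [X]) rawRing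
      (λ {p} {q} → ev-cong p q) ev-add ev-mul ev-neg refl
      (trans (ev-constant A.1#) 1#-homo)

-- Formal quadratic extensions.

-- This is R[γ]/(γ² - Sγ - T), where the pair `(x , y)` stands for x + yγ. As pairs are compared by
-- coordinates, comparing coefficients needs no proof of irreducibility.
module QuadraticExtension (R : CommutativeRing c ℓ) (S T : CommutativeRing.Carrier R) where
  open CommutativeRing R hiding (zero)
  open IntegerSolver R using (solve; _:=_; _:+_; _:*_; _:-_; :-_; con)
  open RingProperties ring using (-0#≈0#)
  private
    C : Set c
    C = Carrier × Carrier

    infix 4 _≈²_
    _≈²_ : C → C → Set ℓ
    (x , y) ≈² (z , w) = x ≈ z × y ≈ w

    _+²_ _*²_ : C → C → C
    (x , y) +² (z , w) = (x + z , y + w)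
    (x , y) *² (z , w) = (x * z + T * (y * w) , x * w + y * z + S * (y * w))

    *²-comm : ∀ x y → x *² y ≈² y *² x
    *²-comm (x , y) (z , w) =
      solve 5 (λ x y z w t → x :* z :+ t :* (y :* w) := z :* x :+ t :* (w :* y)) refl x y z w T ,
      solve 5 (λ x y z w s → x :* w :+ y :* z :+ s :* (y :* w) := z :* y :+ w :* x :+ s :* (w :* y))
           refl x y z w S

    *²-assoc : ∀ x y z → (x *² y) *² z ≈² x *² (y *² z)
    *²-assoc (x , y) (z , w) (u , v) =
      solve 8 (λ x y z w u v s t →
        (x :* z :+ t :* (y :* w)) :* u :+ t :* ((x :* w :+ y :* z :+ s :* (y :* w)) :* v) :=
        x :* (z :* u :+ t :* (w :* v)) :+ t :* (y :* (z :* v :+ w :* u :+ s :* (w :* v))))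
        refl x y z w u v S T ,
      solve 8 (λ x y z w u v s t →
        (x :* z :+ t :* (y :* w)) :* v :+ (x :* w :+ y :* z :+ s :* (y :* w)) :* u :+ s :* ((x :* w :+ y :* z :+ s :* (y :* w)) :* v) :=
        x :* (z :* v :+ w :* u :+ s :* (w :* v)) :+ y :* (z :* u :+ t :* (w :* v)) :+ s :* (y :* (z :* v :+ w :* u :+ s :* (w :* v))))
        refl x y z w u v S T

    *²-distribʳ : ∀ x y z → (y +² z) *² x ≈² (y *² x) +² (z *² x)
    *²-distribʳ (x , y) (z , w) (u , v) =
      solve 7 (λ x y z w u v t →
        (z :+ u) :* x :+ t :* ((w :+ v) :* y) :=
        (z :* x :+ t :* (w :* y)) :+ (u :* x :+ t :* (v :* y)))
        refl x y z w u v T ,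
      solve 7 (λ x y z w u v s →
        (z :+ u) :* y :+ (w :+ v) :* x :+ s :* ((w :+ v) :* y) :=
        (z :* y :+ w :* x :+ s :* (w :* y)) :+ (u :* y :+ v :* x :+ s :* (v :* y)))
        refl x y z w u v S

    *²-cong : ∀ {x y u v} → x ≈² y → u ≈² v → x *² u ≈² y *² v
    *²-cong (p , q) (r , s) =
      +-cong (*-cong p r) (*-congˡ (*-cong q s)) ,
      +-cong (+-cong (*-cong p s) (*-cong q r)) (*-congˡ (*-cong q s))

    1² : C
    1² = (1# , 0#)

    embed-* : ∀ x y w → (x , 0#) *² (y , w) ≈² (x * y , x * w)
    embed-* x y w =
      trans (+-congˡ (trans (*-congˡ (zeroˡ w)) (zeroʳ T))) (+-identityʳ _) ,
      trans (+-cong (trans (+-congˡ (zeroˡ y)) (+-identityʳ _)) (trans (*-congˡ (zeroˡ w)) (zeroʳ S)))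
            (+-identityʳ _)

    ≈²-trans : ∀ {x y z} → x ≈² y → y ≈² z → x ≈² z
    ≈²-trans (p , q) (r , s) = trans p r , trans q s

    *²-identityˡ : ∀ x → 1² *² x ≈² x
    *²-identityˡ (x , y) = ≈²-trans (embed-* 1# x y) (*-identityˡ x , *-identityˡ y)

  commutativeRing : CommutativeRing c ℓ
  commutativeRing = record
    { Carrier = C ; _≈_ = _≈²_ ; _+_ = _+²_ ; _*_ = _*²_
    ; -_ = λ (x , y) → - x , - y ; 0# = 0# , 0# ; 1# = 1²
    ; isCommutativeRing = record
      { isRing = record
        { +-isAbelianGroup = record
          { isGroup = record
            { isMonoid = record
              { isSemigroup = record
                { isMagma = record
                  { isEquivalence = record
                    { refl = refl , refl ; sym = λ (p , q) → sym p , sym q ; trans = ≈²-trans }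
                  ; ∙-cong = λ (p , q) (r , s) → +-cong p r , +-cong q s }
                ; assoc = λ _ _ _ → +-assoc _ _ _ , +-assoc _ _ _ }
              ; identity = (λ _ → +-identityˡ _ , +-identityˡ _) , λ _ → +-identityʳ _ , +-identityʳ _ }
            ; inverse = (λ _ → -‿inverseˡ _ , -‿inverseˡ _) , λ _ → -‿inverseʳ _ , -‿inverseʳ _
            ; ⁻¹-cong = λ (p , q) → -‿cong p , -‿cong q }
          ; comm = λ _ _ → +-comm _ _ , +-comm _ _ }
        ; *-cong = *²-cong
        ; *-assoc = *²-assoc
        ; *-identity = *²-identityˡ , λ x → ≈²-trans (*²-comm x 1²) (*²-identityˡ x)
        ; distrib = (λ x y z → ≈²-trans (*²-comm x (y +² z)) (≈²-trans (*²-distribʳ x y z)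
                       (+-cong (proj₁ (*²-comm y x)) (proj₁ (*²-comm z x)) ,
                        +-cong (proj₂ (*²-comm y x)) (proj₂ (*²-comm z x)))))
                  , *²-distribʳ
        }
      ; *-comm = *²-comm } }

  embed : Carrier → C
  embed x = x , 0#

  embed-isRingHomomorphism : IsRingHomomorphism rawRing (CommutativeRing.rawRing commutativeRing) embed
  embed-isRingHomomorphism = mkRingHom rawRing (CommutativeRing.rawRing commutativeRing)
    (λ p → p , refl)
    (λ x y → refl , sym (+-identityˡ 0#))
    (λ x y → let p , q = embed-* x y 0# in sym p , trans (sym (zeroʳ x)) (sym q))
    (λ x → refl , sym (-0#≈0#))
    (refl , refl)
    (refl , refl)

  -- The two roots γ and S - γ of X² - SX - T, which play the parts of α and β.
  γ γ̄ : C
  γ = 0# , 1#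
  γ̄ = S , - 1#

  private module Q = CommutativeRing commutativeRing

  -- With S = 0 and T = 2 this is the independence of 1 and √2, which holds here by comparing
  -- coordinates.
  independent : ∀ {x y z} → embed x Q.≈ embed y Q.+ embed z Q.* γ → x ≈ y × z ≈ 0#
  independent {x} {y} {z} (p , q) = let u , v = embed-* z 0# 1# in
    trans p (trans (+-congˡ (trans u (zeroʳ z))) (+-identityʳ y)) ,
    sym (trans q (trans (+-identityˡ _) (trans v (*-identityʳ z))))

  γ-square : γ Q.* γ Q.≈ (T , S)
  γ-square =
    trans (+-cong (zeroˡ 0#) (trans (*-congˡ (*-identityˡ 1#)) (*-identityʳ T))) (+-identityˡ T) ,
    trans (+-cong (trans (+-cong (zeroˡ 1#) (zeroʳ 1#)) (+-identityˡ 0#))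
                  (trans (*-congˡ (*-identityˡ 1#)) (*-identityʳ S)))
          (+-identityˡ S)

  γ-sum : γ Q.+ γ̄ Q.≈ embed S
  γ-sum = +-identityˡ S , -‿inverseʳ 1#

  γ-product : Q.- (γ Q.* γ̄) Q.≈ embed T
  γ-product =
    trans (solve 4 (λ e z s t → :- (z :* s :+ t :* (e :* (:- e))) := :- z :* s :+ t :* (e :* e))
         refl 1# 0# S T)
          (trans (+-cong (trans (*-congʳ -0#≈0#) (zeroˡ S))
                         (trans (*-congˡ (*-identityˡ 1#)) (*-identityʳ T)))
                 (+-identityˡ T)) ,
    -- The factor `e :- con (+ 1)` evaluates to `1# - (1# + 0#)`, which the solver leaves in place;
    -- it is cancelled by hand below.
    trans (solve 3 (λ e z s → :- (z :* (:- e) :+ e :* s :+ s :* (e :* (:- e))) := z :* e :+ s :* e :* (e :- con (+ 1)))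
         refl 1# 0# S)
          (trans (+-cong (zeroˡ 1#)
                         (trans (*-congˡ (trans (+-congˡ (-‿cong (+-identityʳ 1#))) (-‿inverseʳ 1#))) (zeroʳ (S * 1#))))
                 (+-identityˡ 0#))

-- Cancellation and the embedding of ℤ in a field of characteristic 0.

module FieldProperties (K : HeytingField c ℓ₁ ℓ₂) where
  open HeytingField K using (tight; #⇒invertible; heytingCommutativeRing)
  commutativeRing : CommutativeRing c ℓ₁
  commutativeRing = HeytingCommutativeRing.commutativeRing heytingCommutativeRing
  open CommutativeRing commutativeRing hiding (zero)
  open RingProperties ring using (-0#≈0#)
  open IntegerEmbedding commutativeRing
  open ≈-Reasoning setoid

  -- Tightness reduces `y ≈ 0#` to refuting the apartness of `y` from `0#`; under that apartness `y`
  -- is invertible and `x` would vanish.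
  xy≈0⇒y≈0 : ∀ {x y} → x * y ≈ 0# → ¬ (x ≈ 0#) → y ≈ 0#
  xy≈0⇒y≈0 {x} {y} xy≈0 x≉0 = proj₁ (tight y 0#) λ y#0 →
    let y⁻¹ , _ , yy⁻¹≈1 = #⇒invertible y#0 in x≉0 (begin
      x                      ≈⟨ *-identityʳ x ⟨
      x * 1#                 ≈⟨ *-congˡ yy⁻¹≈1 ⟨
      x * ((y - 0#) * y⁻¹)   ≈⟨ *-congˡ (*-congʳ (trans (+-congˡ -0#≈0#) (+-identityʳ y))) ⟩
      x * (y * y⁻¹)          ≈⟨ *-assoc x y y⁻¹ ⟨
      x * y * y⁻¹            ≈⟨ *-congʳ xy≈0 ⟩
      0# * y⁻¹               ≈⟨ zeroˡ y⁻¹ ⟩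
      0#                     ∎)

  module _ (char0 : CharacteristicZero K) where
    fromℤ-nonzero : ∀ z → fromℤ z ≈ 0# → z ≡ + 0
    fromℤ-nonzero (+ zero)  z≈0 = ≡.refl
    fromℤ-nonzero (+ suc n) z≈0 = ⊥-elim (char0 (suc n) (s≤s z≤n) z≈0)
    fromℤ-nonzero -[1+ n ]  z≈0 = ⊥-elim (char0 (suc n) (s≤s z≤n)
      (trans (sym (RingProperties.-‿involutive ring _)) (trans (-‿cong z≈0) -0#≈0#)))

    fromℤ-injective : ∀ x y → fromℤ x ≈ fromℤ y → x ≡ y
    fromℤ-injective x y x≈y = ℤ.i-j≡0⇒i≡j x y (fromℤ-nonzero (x ℤ.- y) (begin
      fromℤ (x ℤ.- y)            ≈⟨ fromℤ-+ x (ℤ.- y) ⟩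
      fromℤ x + fromℤ (ℤ.- y)    ≈⟨ +-cong x≈y (fromℤ-neg y) ⟩
      fromℤ y - fromℤ y          ≈⟨ -‿inverseʳ _ ⟩
      0#                         ∎))

-- Values of Lucas atoms as cyclotomic products over a `K`-algebra.

module LucasAtomValues
  (K : HeytingField c ℓ₁ ℓ₂) (ω : ℕ → HeytingField.Carrier K)
  (P : ℕ → RawRing.Carrier ℤ[s,t]) (isLucasAtoms : IsLucasAtoms K ω P)
  (R : CommutativeRing c₁ ℓ)
  {ι : HeytingField.Carrier K → CommutativeRing.Carrier R}
  (ι-hom : IsRingHomomorphism (fieldRawRing K) (CommutativeRing.rawRing R) ι) where
  open CommutativeRing R hiding (zero)
  open IntegerEmbedding R using (fromℤ; fromℤ-isRingHomomorphism)
  open Evaluation rawRing using (eval)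
  open RawSemiringDefs (RawRing.rawSemiring (fieldRawRing K)) using (_^_)
  open ≈-Reasoning setoid

  eval-cong : ∀ {s t s′ t′} → s ≈ s′ → t ≈ t′ → ∀ p → eval p s t ≈ eval p s′ t′
  eval-cong = Compatible.eval~ {_~_ = _≈_} record
    { 0~ = refl ; 1~ = refl ; +~ = +-cong ; *~ = *-cong ; -~ = -‿cong }

  fromℤ-value : ∀ p s t → fromℤ (value p s t) ≈ eval p (fromℤ s) (fromℤ t)
  fromℤ-value p s t = ↦-elim
    (Compatible.eval~ (↦-compatible ℤ-rawRing R fromℤ-isRingHomomorphism) (↦-intro refl) (↦-intro refl) p)

  cyclotomicProduct : ℕ → Carrier → Carrier → Carrier
  cyclotomicProduct n x y = foldr _*_ 1# (map (λ j → x - ι (ω n ^ j) * y) (coprimes n))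

  module _ (x y : Carrier) where
    private
      K[X] = fieldRawRing K [X]
      module K[α,β] = RawRing (K[α,β] K)
      module x = Substitution (fieldRawRing K) R ι-hom x
      module y = Substitution K[X] R x.ev-isRingHomomorphism y

      _~_ : K[α,β].Carrier → Carrier → Set ℓ
      _~_ = _↦_ (K[α,β] K) R y.ev-isRingHomomorphism

      open Compatible {_~_ = _~_} (↦-compatible (K[α,β] K) R y.ev-isRingHomomorphism)

      α~ : α K ~ x
      α~ = ↦-intro (trans (y.ev-constant (Polynomial.X (fieldRawRing K))) x.ev-X)

      β~ : β K ~ y
      β~ = ↦-intro y.ev-X

      scalar~ : ∀ a → scalar K a ~ ι a
      scalar~ a = ↦-intro (trans (y.ev-constant (Polynomial.constant (fieldRawRing K) a)) (x.ev-constant a))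

      factor : HeytingField.Carrier K → ℕ → K[α,β].Carrier
      factor ζ j = α K K[α,β].+ K[α,β].- (scalar K (ζ ^ j) K[α,β].* β K)

      product~ : ∀ ζ js → foldr K[α,β]._*_ K[α,β].1# (map (factor ζ) js)
                        ~ foldr _*_ 1# (map (λ j → x - ι (ζ ^ j) * y) js)
      product~ ζ []       = 1~
      product~ ζ (j ∷ js) = *~ (+~ α~ (-~ (*~ (scalar~ (ζ ^ j)) β~))) (product~ ζ js)

    -- The defining identity of the atom is an equality of polynomials over `K`, so `x` and `y` from
    -- any ring under `K` may be substituted for α and β. Keeping `s` and `t` apart from x + y and
    -- -xy lets them be images of integers.
    eval≈cyclotomicProduct : ∀ {s t} → x + y ≈ s → - (x * y) ≈ t → ∀ n → 2 ≤ n →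
      eval (P n) s t ≈ cyclotomicProduct n x y
    eval≈cyclotomicProduct {s} {t} x+y≈s -xy≈t n 2≤n = begin
      eval (P n) s t        ≈⟨ eval-cong x+y≈s -xy≈t (P n) ⟨
      eval (P n) (x + y) (- (x * y))  ≈⟨ ↦-elim (eval~ (+~ α~ β~) (-~ (*~ α~ β~)) (P n)) ⟨
      y.ev Pₙ               ≈⟨ y.ev-cong Pₙ (Φ K n (ω n)) (IsLucasAtoms.Pₙ isLucasAtoms n 2≤n) ⟩
      y.ev (Φ K n (ω n))    ≈⟨ ↦-elim (product~ (ω n) (coprimes n)) ⟩
      cyclotomicProduct n x y  ∎
      where
      Pₙ = Evaluation.eval (K[α,β] K) (P n) (α K K[α,β].+ β K) (K[α,β].- (α K K[α,β].* β K))

-- Odd integers, Nakayama's lemma and the ring ℤ[ζ].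

Odd : ℤ → Set
Odd z = ∃ λ k → z ≡ + 1 ℤ.+ + 2 ℤ.* k

odd-* : ∀ {x y} → Odd x → Odd y → Odd (x ℤ.* y)
odd-* (k , ≡.refl) (l , ≡.refl) = k ℤ.+ l ℤ.+ + 2 ℤ.* (k ℤ.* l) , identity k l
  where
  identity : ∀ k l → (+ 1 ℤ.+ + 2 ℤ.* k) ℤ.* (+ 1 ℤ.+ + 2 ℤ.* l) ≡ + 1 ℤ.+ + 2 ℤ.* (k ℤ.+ l ℤ.+ + 2 ℤ.* (k ℤ.* l))
  identity = ℤ-Solver.solve-∀

odd-shift : ∀ {x} → Odd x → ∀ y → Odd (x ℤ.- + 2 ℤ.* y)
odd-shift (k , ≡.refl) y = k ℤ.- y , identity k y
  where
  identity : ∀ k y → + 1 ℤ.+ + 2 ℤ.* k ℤ.- + 2 ℤ.* y ≡ + 1 ℤ.+ + 2 ℤ.* (k ℤ.- y)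
  identity = ℤ-Solver.solve-∀

module IntegerSpan (R : CommutativeRing c ℓ) where
  open CommutativeRing R hiding (zero)
  open IntegerEmbedding R
  open IntegerSolver R using (solve; _:=_; _:+_; _:*_; _:-_; :-_; con)
  open RawSemiringDefs (RawRing.rawSemiring rawRing) using (_^_)
  open ≈-Reasoning setoid

  Span : List Carrier → Carrier → Set (c Level.⊔ ℓ)
  Span []       x = Level.Lift c (x ≈ 0#)
  Span (e ∷ es) x = ∃₂ λ a y → Span es y × x ≈ fromℤ a * e + y

  span-resp : ∀ es {x y} → x ≈ y → Span es x → Span es y
  span-resp []       x≈y (Level.lift x≈0)   = Level.lift (trans (sym x≈y) x≈0)
  span-resp (e ∷ es) x≈y (a , u , u∈ , x≈)  = a , u , u∈ , trans (sym x≈y) x≈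

  span-0 : ∀ es → Span es 0#
  span-0 []       = Level.lift refl
  span-0 (e ∷ es) = + 0 , 0# , span-0 es , sym (trans (+-identityʳ _) (zeroˡ e))

  span-+ : ∀ es {x y} → Span es x → Span es y → Span es (x + y)
  span-+ [] (Level.lift x≈0) (Level.lift y≈0) = Level.lift (trans (+-cong x≈0 y≈0) (+-identityˡ 0#))
  span-+ (e ∷ es) {x} {y} (a , u , u∈ , x≈) (b , v , v∈ , y≈) = a ℤ.+ b , u + v , span-+ es u∈ v∈ , (begin
    x + y                               ≈⟨ +-cong x≈ y≈ ⟩
    (fromℤ a * e + u) + (fromℤ b * e + v)  ≈⟨ solve 5 (λ a b e u v →
      (a :* e :+ u) :+ (b :* e :+ v) := (a :+ b) :* e :+ (u :+ v)) refl (fromℤ a) (fromℤ b) e u v ⟩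
    (fromℤ a + fromℤ b) * e + (u + v)   ≈⟨ +-congʳ (*-congʳ (fromℤ-+ a b)) ⟨
    fromℤ (a ℤ.+ b) * e + (u + v)       ∎)

  span-scale : ∀ es k {x} → Span es x → Span es (fromℤ k * x)
  span-scale []       k (Level.lift x≈0) = Level.lift (trans (*-congˡ x≈0) (zeroʳ _))
  span-scale (e ∷ es) k {x} (a , u , u∈ , x≈) = k ℤ.* a , fromℤ k * u , span-scale es k u∈ , (begin
    fromℤ k * x                        ≈⟨ *-congˡ x≈ ⟩
    fromℤ k * (fromℤ a * e + u)
      ≈⟨ solve 4 (λ k a e u → k :* (a :* e :+ u) := k :* a :* e :+ k :* u) refl (fromℤ k) (fromℤ a) e u ⟩
    fromℤ k * fromℤ a * e + fromℤ k * u  ≈⟨ +-congʳ (*-congʳ (fromℤ-* k a)) ⟨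
    fromℤ (k ℤ.* a) * e + fromℤ k * u  ∎)

  span-member : ∀ {es x} → Any (x ≈_) es → Span es x
  span-member {e ∷ es} (here x≈e)  = + 1 , 0# , span-0 es ,
    trans x≈e (trans (sym (*-identityˡ e)) (trans (*-congʳ (sym (+-identityʳ 1#))) (sym (+-identityʳ _))))
  span-member {e ∷ es} {x} (there x∈) = + 0 , x , span-member x∈ ,
    sym (trans (+-congʳ (zeroˡ e)) (+-identityˡ x))

  span-mul : ∀ {es fs w} → All (λ e → Span fs (w * e)) es → ∀ {x} → Span es x → Span fs (w * x)
  span-mul {[]} {fs} {w} [] (Level.lift x≈0) = span-resp fs (sym (trans (*-congˡ x≈0) (zeroʳ w))) (span-0 fs)
  span-mul {e ∷ es} {fs} {w} (we ∷ wes) {x} (a , u , u∈ , x≈) = span-resp fs (begin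
    fromℤ a * (w * e) + w * u
      ≈⟨ solve 4 (λ a w e u → a :* (w :* e) :+ w :* u := w :* (a :* e :+ u)) refl (fromℤ a) w e u ⟩
    w * (fromℤ a * e + u)      ≈⟨ *-congˡ x≈ ⟨
    w * x                      ∎) (span-+ fs (span-scale fs a we) (span-mul wes u∈))

  annihilates-span : ∀ {es w} → All (λ e → w * e ≈ 0#) es → ∀ {x} → Span es x → w * x ≈ 0#
  annihilates-span {[]} [] (Level.lift x≈0) = trans (*-congˡ x≈0) (zeroʳ _)
  annihilates-span {e ∷ es} {w} (we ∷ wes) {x} (a , u , u∈ , x≈) = begin
    w * x                       ≈⟨ *-congˡ x≈ ⟩
    w * (fromℤ a * e + u)
      ≈⟨ solve 4 (λ a w e u → w :* (a :* e :+ u) := a :* (w :* e) :+ w :* u) refl (fromℤ a) w e u ⟩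
    fromℤ a * (w * e) + w * u   ≈⟨ +-cong (trans (*-congˡ we) (zeroʳ _)) (annihilates-span wes u∈) ⟩
    0# + 0#                     ≈⟨ +-identityˡ 0# ⟩
    0#                          ∎

  -- Nakayama's lemma at the prime 2, by Gaussian elimination with odd pivots.
  nakayama : ∀ es →
    All (λ e → ∃ λ d → Odd d × ∃ λ y → Span es y × fromℤ d * e ≈ fromℤ (+ 2) * y) es →
    ∃ λ D → Odd D × All (λ e → fromℤ D * e ≈ 0#) es
  nakayama [] [] = + 1 , (+ 0 , ≡.refl) , []
  nakayama (e ∷ es) ((d , d-odd , y , (a , y′ , y′∈ , y≈) , de≈2y) ∷ rest) =
    -- `D` annihilates the span of `es`, and d′e = 2y′ lies in that span; hence d′D annihilates `e`
    -- too.
    let D , D-odd , D·es≈0 = nakayama es (All.map eliminate rest) in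
    d′ ℤ.* D , odd-* d′-odd D-odd ,
    (begin
      fromℤ (d′ ℤ.* D) * e              ≈⟨ *-congʳ (fromℤ-* d′ D) ⟩
      fromℤ d′ * fromℤ D * e
        ≈⟨ solve 3 (λ d D e → d :* D :* e := D :* (d :* e)) refl (fromℤ d′) (fromℤ D) e ⟩
      fromℤ D * (fromℤ d′ * e)          ≈⟨ *-congˡ d′e≈2y′ ⟩
      fromℤ D * (fromℤ (+ 2) * y′)      ≈⟨ annihilates-span D·es≈0 (span-scale es (+ 2) y′∈) ⟩
      0#                                ∎)
    ∷ All.map (λ {x} Dx≈0 → begin
      fromℤ (d′ ℤ.* D) * x              ≈⟨ *-congʳ (fromℤ-* d′ D) ⟩
      fromℤ d′ * fromℤ D * x            ≈⟨ *-assoc _ _ _ ⟩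
      fromℤ d′ * (fromℤ D * x)          ≈⟨ trans (*-congˡ Dx≈0) (zeroʳ _) ⟩
      0#                                ∎) D·es≈0
    where
    -- In de = 2(ae + y′) the term 2ae moves to the left: the pivot on `e` becomes d - 2a, still
    -- odd, and `e` disappears from the right side.
    d′ : ℤ
    d′ = d ℤ.- + 2 ℤ.* a

    d′-odd : Odd d′
    d′-odd = odd-shift d-odd a

    d′≈ : fromℤ d′ ≈ fromℤ d - fromℤ (+ 2) * fromℤ a
    d′≈ = trans (fromℤ-+ d _) (+-congˡ (trans (fromℤ-neg (+ 2 ℤ.* a)) (-‿cong (fromℤ-* (+ 2) a))))

    d′e≈2y′ : fromℤ d′ * e ≈ fromℤ (+ 2) * y′
    d′e≈2y′ = begin
      fromℤ d′ * e                                   ≈⟨ *-congʳ d′≈ ⟩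
      (fromℤ d - fromℤ (+ 2) * fromℤ a) * e
        ≈⟨ solve 3 (λ d a e → (d :- con (+ 2) :* a) :* e := d :* e :- con (+ 2) :* (a :* e))
             refl (fromℤ d) (fromℤ a) e ⟩
      fromℤ d * e - fromℤ (+ 2) * (fromℤ a * e)      ≈⟨ +-congʳ (trans de≈2y (*-congˡ y≈)) ⟩
      fromℤ (+ 2) * (fromℤ a * e + y′) - fromℤ (+ 2) * (fromℤ a * e)
        ≈⟨ solve 2 (λ u v → con (+ 2) :* (u :+ v) :- con (+ 2) :* u := con (+ 2) :* v) refl (fromℤ a * e) y′ ⟩
      fromℤ (+ 2) * y′                               ∎

    -- Multiplying the relation fx = 2(be + u) by d′ allows d′e to be replaced by 2y′, so that only
    -- the remaining generators occur; the coefficient d′f of `x` stays odd.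
    eliminate : ∀ {x} →
      (∃ λ d → Odd d × ∃ λ y → Span (e ∷ es) y × fromℤ d * x ≈ fromℤ (+ 2) * y) →
      ∃ λ d → Odd d × ∃ λ y → Span es y × fromℤ d * x ≈ fromℤ (+ 2) * y
    eliminate {x} (f , f-odd , z , (b , u , u∈ , z≈) , fx≈2z) =
      d′ ℤ.* f , odd-* d′-odd f-odd ,
      fromℤ (+ 2 ℤ.* b) * y′ + fromℤ d′ * u ,
      span-+ es (span-scale es (+ 2 ℤ.* b) y′∈) (span-scale es d′ u∈) , (begin
        fromℤ (d′ ℤ.* f) * x                   ≈⟨ *-congʳ (fromℤ-* d′ f) ⟩
        fromℤ d′ * fromℤ f * x                 ≈⟨ *-assoc _ _ _ ⟩
        fromℤ d′ * (fromℤ f * x)               ≈⟨ *-congˡ (trans fx≈2z (*-congˡ z≈)) ⟩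
        fromℤ d′ * (fromℤ (+ 2) * (fromℤ b * e + u))
          ≈⟨ solve 4 (λ d b e u → d :* (con (+ 2) :* (b :* e :+ u)) := con (+ 2) :* (b :* (d :* e) :+ d :* u))
               refl (fromℤ d′) (fromℤ b) e u ⟩
        fromℤ (+ 2) * (fromℤ b * (fromℤ d′ * e) + fromℤ d′ * u)
          ≈⟨ *-congˡ (+-congʳ (trans (*-congˡ d′e≈2y′) (solve 2 (λ b y → b :* (con (+ 2) :* y) := con (+ 2) :* b :* y)
               refl (fromℤ b) y′))) ⟩
        fromℤ (+ 2) * (fromℤ (+ 2) * fromℤ b * y′ + fromℤ d′ * u)
          ≈⟨ *-congˡ (+-congʳ (*-congʳ (fromℤ-* (+ 2) b))) ⟨
        fromℤ (+ 2) * (fromℤ (+ 2 ℤ.* b) * y′ + fromℤ d′ * u)  ∎)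

  module RootOfUnity (ζ : Carrier) (n : ℕ) (0<n : 0 < n) (ζⁿ≈1 : ζ ^ n ≈ 1#) where
    powers : List Carrier
    powers = applyUpTo (ζ ^_) n

    power∈ : ∀ {i x} → i < n → x ≈ ζ ^ i → Span powers x
    power∈ i<n x≈ = span-member (Any.applyUpTo⁺ (ζ ^_) x≈ i<n)

    -- The elements of ℤ[ζ], through their action on it.
    Integral : Carrier → Set (c Level.⊔ ℓ)
    Integral x = ∀ {y} → Span powers y → Span powers (x * y)

    -- Multiplication by ζ permutes the listed powers cyclically: the last one goes to ζⁿ = 1 = ζ⁰.
    integral-ζ : Integral ζ
    integral-ζ = span-mul (All.applyUpTo⁺₁ (ζ ^_) n λ {i} i<n → case i (ℕ.m≤n⇒m<n∨m≡n i<n))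
      where
      case : ∀ i → _ → Span powers (ζ * ζ ^ i)
      case i (inj₁ 1+i<n)  = power∈ 1+i<n refl
      case i (inj₂ ≡.refl) = power∈ 0<n ζⁿ≈1

    integral-fromℤ : ∀ z → Integral (fromℤ z)
    integral-fromℤ z = span-scale powers z

    integral-resp : ∀ {x y} → x ≈ y → Integral x → Integral y
    integral-resp x≈y ix u = span-resp powers (*-congʳ x≈y) (ix u)

    integral-+ : ∀ {x y} → Integral x → Integral y → Integral (x + y)
    integral-+ ix iy u = span-resp powers (sym (distribʳ _ _ _)) (span-+ powers (ix u) (iy u))

    integral-* : ∀ {x y} → Integral x → Integral y → Integral (x * y)
    integral-* ix iy u = span-resp powers (sym (*-assoc _ _ _)) (ix (iy u))

    integral-1 : Integral 1#
    integral-1 = integral-resp (+-identityʳ 1#) (integral-fromℤ (+ 1))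

    integral-^ : ∀ {x} k → Integral x → Integral (x ^ k)
    integral-^ zero    ix = integral-1
    integral-^ (suc k) ix = integral-* ix (integral-^ k ix)

    -- If ½ acts on M = ℤ[ζ], then M = 2M, and Nakayama's lemma yields an odd integer that
    -- annihilates M, in particular 1.
    integral-half⇒torsion : ∀ {z} → Integral z → fromℤ (+ 2) * z ≈ 1# → ∃ λ D → Odd D × fromℤ D ≈ 0#
    integral-half⇒torsion {z} iz 2z≈1 =
      let D , D-odd , D·powers≈0 = nakayama powers (All.applyUpTo⁺₁ (ζ ^_) n λ {i} i<n →
            + 1 , (+ 0 , ≡.refl) , z * ζ ^ i , iz (power∈ i<n refl) , (begin
              fromℤ (+ 1) * ζ ^ i          ≈⟨ *-congʳ (trans (+-identityʳ 1#) (sym 2z≈1)) ⟩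
              fromℤ (+ 2) * z * ζ ^ i      ≈⟨ *-assoc _ _ _ ⟩
              fromℤ (+ 2) * (z * ζ ^ i)    ∎))
      in D , D-odd , trans (sym (*-identityʳ _)) (annihilates-span D·powers≈0 (power∈ 0<n refl))

    -- Stands in for being prime to 2 in ℤ[ζ], phrased with elements instead of ideals so that it
    -- passes to products at once.
    DividesOdd : Carrier → Set (c Level.⊔ ℓ)
    DividesOdd x = ∃₂ λ y D → Integral y × Odd D × x * y ≈ fromℤ D

    dividesOdd-resp : ∀ {x y} → x ≈ y → DividesOdd x → DividesOdd y
    dividesOdd-resp x≈y (u , D , iu , D-odd , xu≈D) = u , D , iu , D-odd , trans (*-congʳ (sym x≈y)) xu≈D

    dividesOdd-* : ∀ {x y} → DividesOdd x → DividesOdd y → DividesOdd (x * y)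
    dividesOdd-* {x} {y} (u , D , iu , D-odd , xu≈D) (v , E , iv , E-odd , yv≈E) =
      u * v , D ℤ.* E , integral-* iu iv , odd-* D-odd E-odd , (begin
        x * y * (u * v)
          ≈⟨ solve 4 (λ x y u v → x :* y :* (u :* v) := (x :* u) :* (y :* v)) refl x y u v ⟩
        (x * u) * (y * v)      ≈⟨ *-cong xu≈D yv≈E ⟩
        fromℤ D * fromℤ E      ≈⟨ fromℤ-* D E ⟨
        fromℤ (D ℤ.* E)        ∎)

    dividesOdd-product : ∀ {A : Set} (f : A → Carrier) {js} →
      All (λ j → DividesOdd (f j)) js → DividesOdd (foldr _*_ 1# (map f js))
    dividesOdd-product f [] =
      1# , + 1 , integral-1 , (+ 0 , ≡.refl) , trans (*-identityʳ 1#) (sym (+-identityʳ 1#))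
    dividesOdd-product f (j ∷ js) = dividesOdd-* j (dividesOdd-product f js)

    -- From 2ky = 1 + 2l one reads off ½ = ky - l, which lies in ℤ[ζ].
    even-dividesOdd⇒torsion : ∀ k → DividesOdd (fromℤ (+ 2 ℤ.* k)) → ∃ λ D → Odd D × fromℤ D ≈ 0#
    even-dividesOdd⇒torsion k (y , _ , iy , (l , ≡.refl) , 2ky≈D) = integral-half⇒torsion
      (integral-+ (integral-* (integral-fromℤ k) iy) (integral-fromℤ (ℤ.- l))) (begin
        fromℤ (+ 2) * (fromℤ k * y + fromℤ (ℤ.- l))   ≈⟨ *-congˡ (+-congˡ (fromℤ-neg l)) ⟩
        fromℤ (+ 2) * (fromℤ k * y - fromℤ l)
          ≈⟨ solve 3 (λ k y l → con (+ 2) :* (k :* y :- l) := con (+ 2) :* k :* y :- con (+ 2) :* l)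
               refl (fromℤ k) y (fromℤ l) ⟩
        fromℤ (+ 2) * fromℤ k * y - fromℤ (+ 2) * fromℤ l
          ≈⟨ +-cong (*-congʳ (sym (fromℤ-* (+ 2) k))) (-‿cong (sym (fromℤ-* (+ 2) l))) ⟩
        fromℤ (+ 2 ℤ.* k) * y - fromℤ (+ 2 ℤ.* l)     ≈⟨ +-congʳ 2ky≈D ⟩
        fromℤ (+ 1 ℤ.+ + 2 ℤ.* l) - fromℤ (+ 2 ℤ.* l) ≈⟨ +-congʳ (fromℤ-+ (+ 1) (+ 2 ℤ.* l)) ⟩
        fromℤ (+ 1) + fromℤ (+ 2 ℤ.* l) - fromℤ (+ 2 ℤ.* l)
          ≈⟨ trans (+-assoc _ _ _) (+-congˡ (-‿inverseʳ _)) ⟩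
        fromℤ (+ 1) + 0#                              ≈⟨ trans (+-identityʳ _) (+-identityʳ 1#) ⟩
        1#                                            ∎)

    -- (1 - x) * cofactor x m is the sum of 1 - x^i over i < m.
    geometric cofactor : Carrier → ℕ → Carrier
    geometric x zero    = 0#
    geometric x (suc m) = geometric x m + x ^ m
    cofactor  x zero    = 0#
    cofactor  x (suc m) = cofactor x m + geometric x m

    geometric-telescopes : ∀ x m → (1# - x) * geometric x m ≈ 1# - x ^ m
    geometric-telescopes x zero    = trans (zeroʳ _) (sym (-‿inverseʳ 1#))
    geometric-telescopes x (suc m) = begin
      (1# - x) * (geometric x m + x ^ m)              ≈⟨ distribˡ _ _ _ ⟩
      (1# - x) * geometric x m + (1# - x) * x ^ m
        ≈⟨ +-cong (geometric-telescopes x m) (trans (distribʳ _ _ _) (+-congʳ (*-identityˡ _))) ⟩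
      (1# - x ^ m) + (x ^ m + - x * x ^ m)
        ≈⟨ solve 3 (λ e x y → (e :- y) :+ (y :+ (:- x) :* y) := e :- x :* y) refl 1# x (x ^ m) ⟩
      1# - x * x ^ m                                  ∎

    -- Split each of the m units as xⁱ + (1 - xⁱ). Once the geometric sum vanishes, this exhibits m
    -- as a multiple of 1 - x.
    m≈geometric+cofactor : ∀ x m → fromℤ (+ m) ≈ geometric x m + (1# - x) * cofactor x m
    m≈geometric+cofactor x zero    = sym (trans (+-congˡ (zeroʳ _)) (+-identityʳ 0#))
    m≈geometric+cofactor x (suc m) = begin
      1# + fromℤ (+ m)                                           ≈⟨ +-congˡ (m≈geometric+cofactor x m) ⟩
      1# + (geometric x m + (1# - x) * cofactor x m)             ≈⟨ solve 4 (λ e g h y →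
        e :+ (g :+ h) := (g :+ y) :+ (h :+ (e :- y))) refl 1# (geometric x m) ((1# - x) * cofactor x m) (x ^ m) ⟩
      (geometric x m + x ^ m) + ((1# - x) * cofactor x m + (1# - x ^ m))
        ≈⟨ +-congˡ (+-congˡ (geometric-telescopes x m)) ⟨
      (geometric x m + x ^ m) + ((1# - x) * cofactor x m + (1# - x) * geometric x m)
        ≈⟨ +-congˡ (distribˡ _ _ _) ⟨
      geometric x m + x ^ m + (1# - x) * (cofactor x m + geometric x m)  ∎

    integral-geometric : ∀ {x} m → Integral x → Integral (geometric x m)
    integral-geometric zero    ix = integral-fromℤ (+ 0)
    integral-geometric (suc m) ix = integral-+ (integral-geometric m ix) (integral-^ m ix)

    integral-cofactor : ∀ {x} m → Integral x → Integral (cofactor x m)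
    integral-cofactor zero    ix = integral-fromℤ (+ 0)
    integral-cofactor (suc m) ix = integral-+ (integral-cofactor m ix) (integral-geometric m ix)

    -- 1 - x divides 1 - x^q, which divides m when x^q is a nontrivial m-th
    -- root of unity.
    1-x-dividesOdd : ∀ {x} q m → Odd (+ m) → Integral x → geometric (x ^ q) m ≈ 0# → DividesOdd (1# - x)
    1-x-dividesOdd {x} q m m-odd ix g≈0 =
      geometric x q * cofactor (x ^ q) m , + m ,
      integral-* (integral-geometric q ix) (integral-cofactor m (integral-^ q ix)) , m-odd , (begin
        (1# - x) * (geometric x q * cofactor (x ^ q) m)    ≈⟨ *-assoc _ _ _ ⟨
        (1# - x) * geometric x q * cofactor (x ^ q) m      ≈⟨ *-congʳ (geometric-telescopes x q) ⟩
        (1# - x ^ q) * cofactor (x ^ q) m                  ≈⟨ +-identityˡ _ ⟨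
        0# + (1# - x ^ q) * cofactor (x ^ q) m             ≈⟨ +-congʳ g≈0 ⟨
        geometric (x ^ q) m + (1# - x ^ q) * cofactor (x ^ q) m  ≈⟨ m≈geometric+cofactor (x ^ q) m ⟨
        fromℤ (+ m)                                        ∎)

-- Parity, and the oddness of Φₙ(1).

parity : ∀ z → (∃ λ k → z ≡ + 2 ℤ.* k) ⊎ Odd z
parity z with z ℤ.% + 2 | ℤ.n%d<d z (+ 2) | ℤ.a≡a%n+[a/n]*n z (+ 2)
... | 0           | _               | eq = inj₁ (z ℤ./ + 2 , ≡.trans eq (≡.trans (ℤ.+-identityˡ _) (ℤ.*-comm (z ℤ./ + 2) (+ 2))))
... | 1           | _               | eq = inj₂ (z ℤ./ + 2 , ≡.trans eq (≡.cong (λ x → + 1 ℤ.+ x) (ℤ.*-comm (z ℤ./ + 2) (+ 2))))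
... | suc (suc _) | s≤s (s≤s ())    | _

odd⇒¬even : ∀ {z} → Odd z → ∀ k → z ≢ + 2 ℤ.* k
odd⇒¬even (l , ≡.refl) k eq = contradict (k ℤ.- l) (begin
  + 1                                          ≡⟨ identity l ⟩
  + 1 ℤ.+ + 2 ℤ.* l ℤ.- + 2 ℤ.* l              ≡⟨ ≡.cong (λ x → x ℤ.- + 2 ℤ.* l) eq ⟩
  + 2 ℤ.* k ℤ.- + 2 ℤ.* l                      ≡⟨ identity′ k l ⟩
  + 2 ℤ.* (k ℤ.- l)                            ∎)
  where
  open ≡.≡-Reasoning
  identity : ∀ l → + 1 ≡ + 1 ℤ.+ + 2 ℤ.* l ℤ.- + 2 ℤ.* l
  identity = ℤ-Solver.solve-∀
  identity′ : ∀ k l → + 2 ℤ.* k ℤ.- + 2 ℤ.* l ≡ + 2 ℤ.* (k ℤ.- l)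
  identity′ = ℤ-Solver.solve-∀
  contradict : ∀ k → + 1 ≢ + 2 ℤ.* k
  contradict k eq with ℕ.∣1⇒≡1 (divides ℤ.∣ k ∣ (≡.trans (≡.cong ℤ.∣_∣ eq) (≡.trans (ℤ.abs-* (+ 2) k) (ℕ.*-comm 2 ℤ.∣ k ∣))))
  ... | ()

module PrimitiveRoots (K : HeytingField c ℓ₁ ℓ₂) where
  open FieldProperties K
  open CommutativeRing commutativeRing hiding (zero)
  open IntegerEmbedding commutativeRing
  open IntegerSolver commutativeRing using (solve; _:=_; _:+_; _:*_; _:-_; :-_)
  open IntegerSpan commutativeRing
  open SemiringExp semiring
  open RingProperties ring using (x∙y⁻¹≈ε⇒x≈y)
  open ≈-Reasoning setoid

  ^-one : ∀ n → 1# ^ n ≈ 1#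
  ^-one zero    = refl
  ^-one (suc n) = trans (*-identityˡ _) (^-one n)

  ^-divisible : ∀ {x n} → x ^ n ≈ 1# → ∀ q → x ^ (q ℕ.* n) ≈ 1#
  ^-divisible {x} {n} xⁿ≈1 q = begin
    x ^ (q ℕ.* n)   ≡⟨ ≡.cong (x ^_) (ℕ.*-comm q n) ⟩
    x ^ (n ℕ.* q)   ≈⟨ ^-assocʳ x n q ⟨
    (x ^ n) ^ q     ≈⟨ ^-congˡ q xⁿ≈1 ⟩
    1# ^ q          ≈⟨ ^-one q ⟩
    1#              ∎

  order-divides : ∀ {n ω} .{{_ : NonZero n}} → IsPrimitiveRoot K n ω → ∀ k → ω ^ k ≈ 1# → n ℕ.∣ k
  order-divides {n} {ω} (ωⁿ≈1 , minimal) k ωᵏ≈1 = go (k ℕ.% n) ≡.refl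
    where
    ωʳ≈1 : ω ^ (k ℕ.% n) ≈ 1#
    ωʳ≈1 = begin
      ω ^ (k ℕ.% n)                               ≈⟨ *-identityʳ _ ⟨
      ω ^ (k ℕ.% n) * 1#                          ≈⟨ *-congˡ (^-divisible ωⁿ≈1 (k ℕ./ n)) ⟨
      ω ^ (k ℕ.% n) * ω ^ (k ℕ./ n ℕ.* n)         ≈⟨ ^-homo-* ω (k ℕ.% n) _ ⟨
      ω ^ (k ℕ.% n ℕ.+ k ℕ./ n ℕ.* n)             ≡⟨ ≡.cong (ω ^_) (ℕ.m≡m%n+[m/n]*n k n) ⟨
      ω ^ k                                       ≈⟨ ωᵏ≈1 ⟩
      1#                                          ∎
    go : ∀ r → k ℕ.% n ≡ r → n ℕ.∣ k
    go zero    eq = ℕ.m%n≡0⇒n∣m k n eq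
    go (suc r) eq = ⊥-elim (minimal (suc r) (s≤s z≤n) (≡.subst (_< n) eq (ℕ.m%n<n k n))
                              (≡.subst (λ r → ω ^ r ≈ 1#) eq ωʳ≈1))

  sqrt1≈-1 : ∀ {x} → x * x ≈ 1# → ¬ (x ≈ 1#) → x ≈ - 1#
  sqrt1≈-1 {x} x²≈1 x≉1 = begin
    x                ≈⟨ solve 2 (λ x e → x := x :+ e :- e) refl x 1# ⟩
    x + 1# - 1#      ≈⟨ +-congʳ (xy≈0⇒y≈0 (begin
      (x - 1#) * (x + 1#)            ≈⟨ distribʳ _ _ _ ⟩
      x * (x + 1#) + - 1# * (x + 1#)
        ≈⟨ solve 2 (λ x e → x :* (x :+ e) :+ (:- e) :* (x :+ e) := x :* x :- e :* e) refl x 1# ⟩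
      x * x - 1# * 1#                ≈⟨ +-cong x²≈1 (-‿cong (*-identityˡ 1#)) ⟩
      1# - 1#                        ≈⟨ -‿inverseʳ 1# ⟩
      0#                             ∎) (λ x-1≈0 → x≉1 (x∙y⁻¹≈ε⇒x≈y x 1# x-1≈0))) ⟩
    0# - 1#          ≈⟨ +-identityˡ _ ⟩
    - 1#             ∎

  half-power : ∀ {N ω} → 0 < N → IsPrimitiveRoot K (N ℕ.+ N) ω → ω ^ N ≈ - 1#
  half-power {N} {ω} 0<N (ω²ᴺ≈1 , minimal) =
    sqrt1≈-1 (trans (sym (^-homo-* ω N N)) ω²ᴺ≈1) (minimal N 0<N (ℕ.m<m+n N 0<N))

  -- At α = β = 1 the atom takes the value Φₙ(1).
  module _ (char0 : CharacteristicZero K) (ω : ℕ → Carrier)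
    (P : ℕ → RawRing.Carrier ℤ[s,t]) (isLucasAtoms : IsLucasAtoms K ω P)
    {n : ℕ} (ω-primitive : IsPrimitiveRoot K n (ω n)) (2≤n : 2 ≤ n)
    {m q : ℕ} (n≡q*m : n ≡ q ℕ.* m) (1<m : 1 < m) (m-odd : Odd (+ m)) where
    private
      0<n : 0 < n
      0<n = ℕ.≤-trans (s≤s z≤n) 2≤n

      instance
        n≢0 : NonZero n
        n≢0 = ℕ.>-nonZero 0<n
        qm≢0 : NonZero (q ℕ.* m)
        qm≢0 = ≡.subst NonZero n≡q*m n≢0
        q≢0 : NonZero q
        q≢0 = ℕ.m*n≢0⇒m≢0 q

      open RootOfUnity (ω n) n 0<n (proj₁ ω-primitive)

      factor : ℕ → Carrier
      factor j = 1# - ω n ^ j * 1#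

      -- If ω^(jq) = 1, then n = qm divides qj, so m divides j; being a divisor of n as well, m
      -- would divide gcd(j, n) = 1.
      η≉1 : ∀ {j} → gcd j n ≡ 1 → ¬ ((ω n ^ j) ^ q ≈ 1#)
      η≉1 {j} gcd≡1 η≈1 = ℕ.<⇒≢ 1<m (≡.sym (ℕ.∣1⇒≡1 (≡.subst (m ℕ.∣_) gcd≡1 (gcd-greatest m∣j m∣n))))
        where
        m∣n : m ℕ.∣ n
        m∣n = divides q n≡q*m
        n∣jq : n ℕ.∣ q ℕ.* j
        n∣jq = order-divides ω-primitive (q ℕ.* j)
          (≡.subst (λ i → ω n ^ i ≈ 1#) (ℕ.*-comm j q) (trans (sym (^-assocʳ (ω n) j q)) η≈1))
        m∣j : m ℕ.∣ j
        m∣j = ℕ.*-cancelˡ-∣ q (≡.subst (ℕ._∣ q ℕ.* j) n≡q*m n∣jq)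

      -- As η = ω^(jq) is an m-th root of unity other than 1, the equation (1 - η)(1 + η + ... +
      -- η^(m-1)) = 1 - ηᵐ = 0 forces the geometric sum to vanish.
      factor-dividesOdd : ∀ {j} → gcd j n ≡ 1 → DividesOdd (factor j)
      factor-dividesOdd {j} gcd≡1 = dividesOdd-resp (+-congˡ (-‿cong (sym (*-identityʳ _))))
        (1-x-dividesOdd q m m-odd (integral-^ j integral-ζ) (xy≈0⇒y≈0 (begin
          (1# - η) * geometric η m   ≈⟨ geometric-telescopes η m ⟩
          1# - η ^ m                 ≈⟨ +-congˡ (-‿cong ηᵐ≈1) ⟩
          1# - 1#                    ≈⟨ -‿inverseʳ 1# ⟩
          0#                         ∎) (λ 1-η≈0 → η≉1 {j} gcd≡1 (sym (x∙y⁻¹≈ε⇒x≈y 1# η 1-η≈0)))))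
        where
        η : Carrier
        η = (ω n ^ j) ^ q
        ηᵐ≈1 : η ^ m ≈ 1#
        ηᵐ≈1 = begin
          ((ω n ^ j) ^ q) ^ m    ≈⟨ ^-assocʳ (ω n ^ j) q m ⟩
          (ω n ^ j) ^ (q ℕ.* m)  ≡⟨ ≡.cong ((ω n ^ j) ^_) n≡q*m ⟨
          (ω n ^ j) ^ n          ≈⟨ ^-assocʳ (ω n) j n ⟩
          ω n ^ (j ℕ.* n)        ≈⟨ ^-divisible (proj₁ ω-primitive) j ⟩
          1#                     ∎

      id-isRingHomomorphism : IsRingHomomorphism rawRing rawRing id
      id-isRingHomomorphism = mkRingHom rawRing rawRing id (λ _ _ → refl) (λ _ _ → refl) (λ _ → refl) refl refl

      open LucasAtomValues K ω P isLucasAtoms commutativeRing id-isRingHomomorphism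

      value-dividesOdd : DividesOdd (fromℤ (value (P n) (+ 2) -[1+ 0 ]))
      value-dividesOdd = dividesOdd-resp (sym (trans (fromℤ-value (P n) (+ 2) -[1+ 0 ])
          (eval≈cyclotomicProduct 1# 1# (+-congˡ (sym (+-identityʳ 1#)))
            (-‿cong (trans (*-identityˡ 1#) (sym (+-identityʳ 1#)))) n 2≤n)))
        (dividesOdd-product factor
          (All.map (λ {j} → factor-dividesOdd {j}) (All.all-filter (λ j → gcd j n ℕ.≟ 1) (map suc (upTo n)))))

    value-2,-1-odd : Odd (value (P n) (+ 2) -[1+ 0 ])
    value-2,-1-odd with parity (value (P n) (+ 2) -[1+ 0 ])
    ... | inj₂ odd        = odd
    ... | inj₁ (k , eq) =
      let D , D-odd , D≈0 = even-dividesOdd⇒torsion k (≡.subst (DividesOdd ∘ fromℤ) eq value-dividesOdd)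
      in ⊥-elim (odd⇒¬even D-odd (+ 0) (fromℤ-nonzero char0 D D≈0))

-- Products over the odd powers of a root of unity.

module ProductsOverRange (R : CommutativeRing c ℓ) where
  open CommutativeRing R hiding (zero)
  open IntegerSolver R using (solve; _:=_; _:+_; _:*_; _:-_; :-_)
  open CommutativeSemiringExp commutativeSemiring using (_^_; ^-homo-*; ^-distrib-*)
  open ≈-Reasoning setoid

  ∏ : (ℕ → Carrier) → ℕ → Carrier
  ∏ f n = foldr _*_ 1# (applyUpTo f n)

  ∏-cong : ∀ {f g} → (∀ i → f i ≈ g i) → ∀ n → ∏ f n ≈ ∏ g n
  ∏-cong f≈g zero    = refl
  ∏-cong f≈g (suc n) = *-cong (f≈g 0) (∏-cong (f≈g ∘ suc) n)

  ∏-split : ∀ f m n → ∏ f (m ℕ.+ n) ≈ ∏ f m * ∏ (λ i → f (m ℕ.+ i)) n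
  ∏-split f zero    n = sym (*-identityˡ _)
  ∏-split f (suc m) n = trans (*-congˡ (∏-split (f ∘ suc) m n)) (sym (*-assoc _ _ _))

  ∏-* : ∀ f g n → ∏ f n * ∏ g n ≈ ∏ (λ i → f i * g i) n
  ∏-* f g zero    = *-identityˡ 1#
  ∏-* f g (suc n) = trans
    (solve 4 (λ a b c d → (a :* b) :* (c :* d) := (a :* c) :* (b :* d))
         refl (f 0) (∏ (f ∘ suc) n) (g 0) (∏ (g ∘ suc) n))
    (*-congˡ (∏-* (f ∘ suc) (g ∘ suc) n))

  ^-double : ∀ x k → x ^ (2 ℕ.^ suc k) ≈ x ^ (2 ℕ.^ k) * x ^ (2 ℕ.^ k)
  ^-double x k = trans (^-homo-* x (2 ℕ.^ k) _) (*-congˡ (reflexive (≡.cong (x ^_) (ℕ.+-identityʳ (2 ℕ.^ k)))))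

  -- The factors i and i + 2ᵏ combine to x² - ζ^(2(2i+1)) y², as ζ^(2ᵏ⁺¹) = -1.
  ∏-odd-powers : ∀ k ζ x y → ζ ^ (2 ℕ.^ k) ≈ - 1# →
    ∏ (λ i → x - ζ ^ suc (i ℕ.+ i) * y) (2 ℕ.^ k) ≈ x ^ (2 ℕ.^ k) + y ^ (2 ℕ.^ k)
  ∏-odd-powers zero ζ x y ζ≈-1 = begin
    (x - ζ * 1# * y) * 1#        ≈⟨ *-congʳ (+-congˡ (-‿cong (*-congʳ ζ≈-1))) ⟩
    (x - - 1# * y) * 1#
      ≈⟨ solve 3 (λ x y e → (x :- (:- e) :* y) :* e := x :* e :+ y :* (e :* e)) refl x y 1# ⟩
    x * 1# + y * (1# * 1#)       ≈⟨ +-congˡ (*-congˡ (*-identityˡ 1#)) ⟩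
    x * 1# + y * 1#              ∎
  ∏-odd-powers (suc k) ζ x y ζ²ᴺ≈-1 = begin
    ∏ f (2 ℕ.^ suc k)                            ≡⟨ ≡.cong (λ m → ∏ f (N ℕ.+ m)) (ℕ.+-identityʳ N) ⟩
    ∏ f (N ℕ.+ N)                                ≈⟨ ∏-split f N N ⟩
    ∏ f N * ∏ (λ i → f (N ℕ.+ i)) N              ≈⟨ ∏-* f _ N ⟩
    ∏ (λ i → f i * f (N ℕ.+ i)) N                ≈⟨ ∏-cong combine N ⟩
    ∏ (λ i → x * x - (ζ * ζ) ^ suc (i ℕ.+ i) * (y * y)) N
      ≈⟨ ∏-odd-powers k (ζ * ζ) (x * x) (y * y) (trans (^-distrib-* ζ ζ N) (trans (sym (^-double ζ k)) ζ²ᴺ≈-1)) ⟩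
    (x * x) ^ N + (y * y) ^ N                    ≈⟨ +-cong (square x) (square y) ⟩
    x ^ (2 ℕ.^ suc k) + y ^ (2 ℕ.^ suc k)        ∎
    where
    N : ℕ
    N = 2 ℕ.^ k
    f : ℕ → Carrier
    f i = x - ζ ^ suc (i ℕ.+ i) * y
    square : ∀ z → (z * z) ^ N ≈ z ^ (2 ℕ.^ suc k)
    square z = trans (^-distrib-* z z N) (sym (^-double z k))
    shift : ∀ i → ζ ^ suc (N ℕ.+ i ℕ.+ (N ℕ.+ i)) ≈ - 1# * ζ ^ suc (i ℕ.+ i)
    shift i = begin
      ζ ^ suc (N ℕ.+ i ℕ.+ (N ℕ.+ i))            ≡⟨ ≡.cong (ζ ^_) (rearrange N i) ⟩
      ζ ^ (2 ℕ.^ suc k ℕ.+ suc (i ℕ.+ i))        ≈⟨ ^-homo-* ζ (2 ℕ.^ suc k) _ ⟩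
      ζ ^ (2 ℕ.^ suc k) * ζ ^ suc (i ℕ.+ i)      ≈⟨ *-congʳ ζ²ᴺ≈-1 ⟩
      - 1# * ζ ^ suc (i ℕ.+ i)                   ∎
      where
      open import Data.Nat.Tactic.RingSolver using (solve-∀)
      rearrange : ∀ N i → suc (N ℕ.+ i ℕ.+ (N ℕ.+ i)) ≡ N ℕ.+ (N ℕ.+ 0) ℕ.+ suc (i ℕ.+ i)
      rearrange = solve-∀
    combine : ∀ i → f i * f (N ℕ.+ i) ≈ x * x - (ζ * ζ) ^ suc (i ℕ.+ i) * (y * y)
    combine i = begin
      f i * f (N ℕ.+ i)                          ≈⟨ *-congˡ (+-congˡ (-‿cong (*-congʳ (shift i)))) ⟩
      (x - z * y) * (x - - 1# * z * y)
        ≈⟨ *-congˡ (solve 4 (λ x y z e → x :- (:- e) :* z :* y := x :+ e :* (z :* y)) refl x y z 1#) ⟩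
      (x - z * y) * (x + 1# * (z * y))           ≈⟨ *-congˡ (+-congˡ (*-identityˡ _)) ⟩
      (x - z * y) * (x + z * y)
        ≈⟨ solve 3 (λ x y z → (x :- z :* y) :* (x :+ z :* y) := x :* x :- z :* z :* (y :* y)) refl x y z ⟩
      x * x - z * z * (y * y)
        ≈⟨ +-congˡ (-‿cong (*-congʳ (^-distrib-* ζ ζ (suc (i ℕ.+ i))))) ⟨
      x * x - (ζ * ζ) ^ suc (i ℕ.+ i) * (y * y)  ∎
      where
      z : Carrier
      z = ζ ^ suc (i ℕ.+ i)

-- The 2-adic valuation.

odd⇒2∤ : ∀ {z} → Odd z → ¬ (2 ℕ.∣ ℤ.∣ z ∣)
odd⇒2∤ {z} z-odd 2∣z with ∣ᵤ⇒∣ {+ 2} {z} 2∣z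
... | Signed.divides q z≡q*2 = odd⇒¬even z-odd q (≡.trans z≡q*2 (ℤ.*-comm q (+ 2)))

2∤⇒odd : ∀ {z} → ¬ (2 ℕ.∣ ℤ.∣ z ∣) → Odd z
2∤⇒odd {z} 2∤z with parity z
... | inj₂ odd        = odd
... | inj₁ (k , ≡.refl) = ⊥-elim (2∤z (≡.subst (2 ℕ.∣_) (≡.sym (ℤ.abs-* (+ 2) k)) (ℕ.m∣m*n ℤ.∣ k ∣)))

odd-part : ∀ n → 0 < n → ∃₂ λ k o → n ≡ 2 ℕ.^ k ℕ.* o × ¬ (2 ℕ.∣ o)
odd-part = <-rec _ step
  where
  step : ∀ n → (∀ {m} → m < n → 0 < m → ∃₂ λ k o → m ≡ 2 ℕ.^ k ℕ.* o × ¬ (2 ℕ.∣ o)) →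
         0 < n → ∃₂ λ k o → n ≡ 2 ℕ.^ k ℕ.* o × ¬ (2 ℕ.∣ o)
  step n rec 0<n with 2 ∣? n
  ... | no 2∤n = 0 , n , ≡.sym (ℕ.*-identityˡ n) , 2∤n
  ... | yes (divides q@(suc _) ≡.refl) =
    let k , o , q≡ , 2∤o = rec {q} (ℕ.m<m*n q 2 (s≤s (s≤s z≤n))) (s≤s z≤n) in
    suc k , o , ≡.trans (≡.cong (ℕ._* 2) q≡) (rearrange (2 ℕ.^ k) o) , 2∤o
    where
    rearrange : ∀ p o → p ℕ.* o ℕ.* 2 ≡ 2 ℕ.* p ℕ.* o
    rearrange = ℕ-Solver.solve-∀
  ... | yes (divides zero ≡.refl) = ⊥-elim (ℕ.n≮0 0<n)

foldr-⊔-upper : ∀ {xs k} → All (_≤ k) xs → foldr _⊔_ 0 xs ≤ k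
foldr-⊔-upper []         = z≤n
foldr-⊔-upper (x≤ ∷ xs≤) = ℕ.⊔-lub x≤ (foldr-⊔-upper xs≤)

foldr-⊔-member : ∀ {xs k} → k ∈ xs → k ≤ foldr _⊔_ 0 xs
foldr-⊔-member {x ∷ xs} (here ≡.refl) = ℕ.m≤m⊔n x _
foldr-⊔-member {x ∷ xs} (there k∈) = ℕ.≤-trans (foldr-⊔-member k∈) (ℕ.m≤n⊔m x _)

k<2^k : ∀ k → k < 2 ℕ.^ k
k<2^k zero    = s≤s z≤n
k<2^k (suc k) = ℕ.≤-trans (ℕ.+-mono-≤ (ℕ.m^n>0 2 k) (k<2^k k))
  (ℕ.≤-reflexive (≡.cong (2 ℕ.^ k ℕ.+_) (≡.sym (ℕ.+-identityʳ _))))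

^-mono-∣ : ∀ {k l} → k ≤ l → 2 ℕ.^ k ℕ.∣ 2 ℕ.^ l
^-mono-∣ {k} {l} k≤l = ≡.subst (λ l → 2 ℕ.^ k ℕ.∣ 2 ℕ.^ l) (ℕ.m+[n∸m]≡n k≤l)
  (≡.subst (2 ℕ.^ k ℕ.∣_) (≡.sym (ℕ.^-distribˡ-+-* 2 k (l ℕ.∸ k))) (ℕ.m∣m*n _))

v₂ℕ-exact : ∀ m k → 0 < m → 2 ℕ.^ k ℕ.∣ m → ¬ (2 ℕ.^ suc k ℕ.∣ m) → v₂ℕ m ≡ [ k ]
v₂ℕ-exact m@(suc _) k 0<m 2ᵏ∣m 2ᵏ⁺¹∤m = ≡.cong [_] (ℕ.≤-antisym
  (foldr-⊔-upper (All.map bound (All.all-filter (λ k → 2 ℕ.^ k ∣? m) (upTo m))))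
  -- The search in `v₂ℕ` runs over exponents below m; since k < 2ᵏ ≤ m, the exponent k is among
  -- them.
  (foldr-⊔-member (∈-filter⁺ (λ k → 2 ℕ.^ k ∣? m) (∈-upTo⁺ (ℕ.<-≤-trans (k<2^k k) (ℕ.∣⇒≤ 2ᵏ∣m))) 2ᵏ∣m)))
  where
  bound : ∀ {l} → 2 ℕ.^ l ℕ.∣ m → l ≤ k
  bound {l} 2ˡ∣m = ℕ.≮⇒≥ λ k<l → 2ᵏ⁺¹∤m (ℕ.∣-trans (^-mono-∣ k<l) 2ˡ∣m)

v₂ℕ-2^k*odd : ∀ k o → ¬ (2 ℕ.∣ o) → v₂ℕ (2 ℕ.^ k ℕ.* o) ≡ [ k ]
v₂ℕ-2^k*odd k zero        2∤o = ⊥-elim (2∤o (divides 0 ≡.refl))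
v₂ℕ-2^k*odd k o@(suc _) 2∤o = v₂ℕ-exact (2 ℕ.^ k ℕ.* o) k
  (ℕ.*-mono-≤ (ℕ.m^n>0 2 k) (s≤s z≤n)) (ℕ.m∣m*n o)
  (λ 2ᵏ⁺¹∣ → 2∤o (ℕ.*-cancelˡ-∣ (2 ℕ.^ k) {{ℕ.m^n≢0 2 k}} (≡.subst (ℕ._∣ 2 ℕ.^ k ℕ.* o) (ℕ.*-comm 2 (2 ℕ.^ k)) 2ᵏ⁺¹∣)))

-- Stated for every `m` because s′² + t′ can be 0 when n = 4; both sides are then `⊤⁺`.
v₂ℕ-2^k* : ∀ k m → v₂ℕ (2 ℕ.^ k ℕ.* m) ≡ k +⁺ v₂ℕ m
v₂ℕ-2^k* k zero      = ≡.cong v₂ℕ (ℕ.*-zeroʳ (2 ℕ.^ k))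
v₂ℕ-2^k* k m@(suc _) with odd-part m (s≤s z≤n)
... | j , o , m≡ , 2∤o = begin
  v₂ℕ (2 ℕ.^ k ℕ.* m)                    ≡⟨ ≡.cong (λ m → v₂ℕ (2 ℕ.^ k ℕ.* m)) m≡ ⟩
  v₂ℕ (2 ℕ.^ k ℕ.* (2 ℕ.^ j ℕ.* o))      ≡⟨ ≡.cong v₂ℕ (ℕ.*-assoc (2 ℕ.^ k) _ o) ⟨
  v₂ℕ (2 ℕ.^ k ℕ.* 2 ℕ.^ j ℕ.* o)        ≡⟨ ≡.cong (λ p → v₂ℕ (p ℕ.* o)) (ℕ.^-distribˡ-+-* 2 k j) ⟨
  v₂ℕ (2 ℕ.^ (k ℕ.+ j) ℕ.* o)            ≡⟨ v₂ℕ-2^k*odd (k ℕ.+ j) o 2∤o ⟩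
  k +⁺ [ j ]                             ≡⟨ ≡.cong (k +⁺_) (v₂ℕ-2^k*odd j o 2∤o) ⟨
  k +⁺ v₂ℕ (2 ℕ.^ j ℕ.* o)               ≡⟨ ≡.cong (λ m → k +⁺ v₂ℕ m) m≡ ⟨
  k +⁺ v₂ℕ m                             ∎
  where open ≡.≡-Reasoning

2^ : ℕ → ℤ
2^ k = + (2 ℕ.^ k)

2^-+ : ∀ m n → 2^ (m ℕ.+ n) ≡ 2^ m ℤ.* 2^ n
2^-+ m n = ≡.trans (≡.cong +_ (ℕ.^-distribˡ-+-* 2 m n)) (ℤ.pos-* (2 ℕ.^ m) (2 ℕ.^ n))

v₂-2^k*odd : ∀ k {o} → Odd o → v₂ (2^ k ℤ.* o) ≡ [ k ]
v₂-2^k*odd k {o} o-odd = ≡.trans (≡.cong v₂ℕ (ℤ.abs-* (2^ k) o)) (v₂ℕ-2^k*odd k ℤ.∣ o ∣ (odd⇒2∤ o-odd))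

v₂-2^k* : ∀ k z → v₂ (2^ k ℤ.* z) ≡ k +⁺ v₂ z
v₂-2^k* k z = ≡.trans (≡.cong v₂ℕ (ℤ.abs-* (2^ k) z)) (v₂ℕ-2^k* k ℤ.∣ z ∣)

-- Valuations of the power sums α^(2ᵏ) + β^(2ᵏ).

-- With s = α + β and t = -αβ: norm s t k = (αβ)^(2ᵏ) and trace s t k = α^(2ᵏ) + β^(2ᵏ).
norm trace : ℤ → ℤ → ℕ → ℤ
norm  s t zero    = ℤ.- t
norm  s t (suc k) = norm s t k ℤ.* norm s t k
trace s t zero    = s
trace s t (suc k) = trace s t k ℤ.* trace s t k ℤ.- + 2 ℤ.* norm s t k

module TraceValuation (s′ t′ : ℤ) (t′-odd : Odd t′) (a b : ℕ) (a+a≡b+1 : a ℕ.+ a ≡ b ℕ.+ 1) where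
  open ≡.≡-Reasoning
  s t : ℤ
  s = 2^ a ℤ.* s′
  t = 2^ b ℤ.* t′

  2^-double : ∀ k → 2^ (2 ℕ.^ suc k ℕ.* b) ≡ 2^ (2 ℕ.^ k ℕ.* b) ℤ.* 2^ (2 ℕ.^ k ℕ.* b)
  2^-double k = ≡.trans (≡.cong 2^ (identity (2 ℕ.^ k) b)) (2^-+ (2 ℕ.^ k ℕ.* b) (2 ℕ.^ k ℕ.* b))
    where
    identity : ∀ p b → (p ℕ.+ (p ℕ.+ 0)) ℕ.* b ≡ p ℕ.* b ℕ.+ p ℕ.* b
    identity = ℕ-Solver.solve-∀

  norm-form : ∀ k → ∃ λ o → Odd o × norm s t k ≡ 2^ (2 ℕ.^ k ℕ.* b) ℤ.* o
  norm-form zero    = ℤ.- t′ , odd-neg t′-odd , (begin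
    ℤ.- (2^ b ℤ.* t′)              ≡⟨ ℤ.neg-distribʳ-* (2^ b) t′ ⟩
    2^ b ℤ.* ℤ.- t′                ≡⟨ ≡.cong (λ b → 2^ b ℤ.* ℤ.- t′) (ℕ.*-identityˡ b) ⟨
    2^ (1 ℕ.* b) ℤ.* ℤ.- t′        ∎)
    where
    odd-neg : ∀ {x} → Odd x → Odd (ℤ.- x)
    odd-neg (k , ≡.refl) = ℤ.- k ℤ.- + 1 , identity k
      where
      identity : ∀ k → ℤ.- (+ 1 ℤ.+ + 2 ℤ.* k) ≡ + 1 ℤ.+ + 2 ℤ.* (ℤ.- k ℤ.- + 1)
      identity = ℤ-Solver.solve-∀
  norm-form (suc k) with norm-form k
  ... | o , o-odd , eq = o ℤ.* o , odd-* o-odd o-odd , (begin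
    norm s t k ℤ.* norm s t k      ≡⟨ ≡.cong₂ ℤ._*_ eq eq ⟩
    (A ℤ.* o) ℤ.* (A ℤ.* o)        ≡⟨ identity A o ⟩
    (A ℤ.* A) ℤ.* (o ℤ.* o)        ≡⟨ ≡.cong (ℤ._* (o ℤ.* o)) (2^-double k) ⟨
    2^ (2 ℕ.^ suc k ℕ.* b) ℤ.* (o ℤ.* o)  ∎)
    where
    A = 2^ (2 ℕ.^ k ℕ.* b)
    identity : ∀ A o → (A ℤ.* o) ℤ.* (A ℤ.* o) ≡ (A ℤ.* A) ℤ.* (o ℤ.* o)
    identity = ℤ-Solver.solve-∀

  -- Since 2a = b + 1, the terms s² and 2t carry the same power of 2. Neither dominates, which is
  -- why s′² + t′ enters the formula for n = 4.
  trace-1 : trace s t 1 ≡ 2^ (b ℕ.+ 1) ℤ.* (s′ ℤ.* s′ ℤ.+ t′)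
  trace-1 = begin
    (2^ a ℤ.* s′) ℤ.* (2^ a ℤ.* s′) ℤ.- + 2 ℤ.* ℤ.- (2^ b ℤ.* t′)
      ≡⟨ identity (2^ a) (2^ b) s′ t′ ⟩
    (2^ a ℤ.* 2^ a) ℤ.* (s′ ℤ.* s′) ℤ.+ (2^ b ℤ.* + 2) ℤ.* t′
      ≡⟨ ≡.cong₂ (λ x y → x ℤ.* (s′ ℤ.* s′) ℤ.+ y ℤ.* t′) (≡.trans (≡.sym (2^-+ a a)) (≡.cong 2^ a+a≡b+1)) (≡.sym (2^-+ b 1)) ⟩
    2^ (b ℕ.+ 1) ℤ.* (s′ ℤ.* s′) ℤ.+ 2^ (b ℕ.+ 1) ℤ.* t′
      ≡⟨ ℤ.*-distribˡ-+ (2^ (b ℕ.+ 1)) (s′ ℤ.* s′) t′ ⟨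
    2^ (b ℕ.+ 1) ℤ.* (s′ ℤ.* s′ ℤ.+ t′)  ∎
    where
    identity : ∀ A B s t → (A ℤ.* s) ℤ.* (A ℤ.* s) ℤ.- + 2 ℤ.* ℤ.- (B ℤ.* t) ≡ (A ℤ.* A) ℤ.* (s ℤ.* s) ℤ.+ (B ℤ.* + 2) ℤ.* t
    identity = ℤ-Solver.solve-∀

  -- The square is divisible by 2 to the power 2ᵏ⁺¹b + 2, while twice the norm has valuation exactly
  -- 2ᵏ⁺¹b + 1 and so dominates. The cofactor `z` is arbitrary so that the induction can start from
  -- `trace-1`, where it is the even number s′² + t′.
  trace-step : ∀ k z → trace s t (suc k) ≡ 2^ (2 ℕ.^ k ℕ.* b ℕ.+ 1) ℤ.* z →
    ∃ λ o → Odd o × trace s t (suc (suc k)) ≡ 2^ (2 ℕ.^ suc k ℕ.* b ℕ.+ 1) ℤ.* o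
  trace-step k z eq with norm-form (suc k)
  ... | o , (l , ≡.refl) , eq′ = + 2 ℤ.* (z ℤ.* z) ℤ.- o , (z ℤ.* z ℤ.- l ℤ.- + 1 , identity z l) , (begin
    trace s t (suc k) ℤ.* trace s t (suc k) ℤ.- + 2 ℤ.* norm s t (suc k)
      ≡⟨ ≡.cong₂ (λ x y → x ℤ.* x ℤ.- + 2 ℤ.* y) (≡.trans eq (≡.cong (ℤ._* z) (2^-+ (2 ℕ.^ k ℕ.* b) 1))) eq′ ⟩
    (A ℤ.* + 2 ℤ.* z) ℤ.* (A ℤ.* + 2 ℤ.* z) ℤ.- + 2 ℤ.* (2^ (2 ℕ.^ suc k ℕ.* b) ℤ.* o)
      ≡⟨ ≡.cong (λ x → (A ℤ.* + 2 ℤ.* z) ℤ.* (A ℤ.* + 2 ℤ.* z) ℤ.- + 2 ℤ.* (x ℤ.* o)) (2^-double k) ⟩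
    (A ℤ.* + 2 ℤ.* z) ℤ.* (A ℤ.* + 2 ℤ.* z) ℤ.- + 2 ℤ.* (A ℤ.* A ℤ.* o)
      ≡⟨ identity′ A z o ⟩
    A ℤ.* A ℤ.* + 2 ℤ.* (+ 2 ℤ.* (z ℤ.* z) ℤ.- o)
      ≡⟨ ≡.cong (λ x → x ℤ.* + 2 ℤ.* (+ 2 ℤ.* (z ℤ.* z) ℤ.- o)) (2^-double k) ⟨
    2^ (2 ℕ.^ suc k ℕ.* b) ℤ.* + 2 ℤ.* (+ 2 ℤ.* (z ℤ.* z) ℤ.- o)
      ≡⟨ ≡.cong (ℤ._* (+ 2 ℤ.* (z ℤ.* z) ℤ.- o)) (2^-+ (2 ℕ.^ suc k ℕ.* b) 1) ⟨
    2^ (2 ℕ.^ suc k ℕ.* b ℕ.+ 1) ℤ.* (+ 2 ℤ.* (z ℤ.* z) ℤ.- o)  ∎)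
    where
    A = 2^ (2 ℕ.^ k ℕ.* b)
    identity : ∀ z l → + 2 ℤ.* (z ℤ.* z) ℤ.- (+ 1 ℤ.+ + 2 ℤ.* l) ≡ + 1 ℤ.+ + 2 ℤ.* (z ℤ.* z ℤ.- l ℤ.- + 1)
    identity = ℤ-Solver.solve-∀
    identity′ : ∀ A z o → (A ℤ.* + 2 ℤ.* z) ℤ.* (A ℤ.* + 2 ℤ.* z) ℤ.- + 2 ℤ.* (A ℤ.* A ℤ.* o) ≡ A ℤ.* A ℤ.* + 2 ℤ.* (+ 2 ℤ.* (z ℤ.* z) ℤ.- o)
    identity′ = ℤ-Solver.solve-∀

  trace-form : ∀ k → ∃ λ o → Odd o × trace s t (suc (suc k)) ≡ 2^ (2 ℕ.^ suc k ℕ.* b ℕ.+ 1) ℤ.* o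
  trace-form zero    = trace-step 0 (s′ ℤ.* s′ ℤ.+ t′)
    (≡.trans trace-1 (≡.cong (λ b → 2^ (b ℕ.+ 1) ℤ.* (s′ ℤ.* s′ ℤ.+ t′)) (≡.sym (ℕ.*-identityˡ b))))
  trace-form (suc k) with trace-form k
  ... | o , _ , eq = trace-step (suc k) o eq

-- The numbers coprime to a power of 2.

filter-alternate : ∀ {A : Set} {P : Pred A 0ℓ} (P? : Decidable P) (f : ℕ → A) →
  (∀ i → P (f (i ℕ.+ i))) → (∀ i → ¬ P (f (suc (i ℕ.+ i)))) →
  ∀ n → filter P? (applyUpTo f (n ℕ.+ n)) ≡ applyUpTo (λ i → f (i ℕ.+ i)) n
filter-alternate {_} P? f even odd zero = ≡.refl
filter-alternate {_} {P} P? f even odd (suc n) = begin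
  filter P? (applyUpTo f (suc n ℕ.+ suc n))
    ≡⟨ ≡.cong (λ m → filter P? (applyUpTo f (suc m))) (ℕ.+-suc n n) ⟩
  filter P? (f 0 ∷ f 1 ∷ applyUpTo f″ (n ℕ.+ n)) ≡⟨ List.filter-accept P? (even 0) ⟩
  f 0 ∷ filter P? (f 1 ∷ applyUpTo f″ (n ℕ.+ n)) ≡⟨ ≡.cong (f 0 ∷_) (List.filter-reject P? (odd 0)) ⟩
  f 0 ∷ filter P? (applyUpTo f″ (n ℕ.+ n))
    ≡⟨ ≡.cong (f 0 ∷_) (filter-alternate P? f″ (λ i → ≡.subst (P ∘ f) (shift i) (even (suc i)))
                                             (λ i → odd (suc i) ∘ ≡.subst (P ∘ f ∘ suc) (≡.sym (shift i))) n) ⟩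
  f 0 ∷ applyUpTo (λ i → f″ (i ℕ.+ i)) n
    ≡⟨ ≡.cong (f 0 ∷_) (applyUpTo-cong (λ i → ≡.cong f (shift i)) n) ⟨
  f 0 ∷ applyUpTo (λ i → f (suc i ℕ.+ suc i)) n  ∎
  where
  open ≡.≡-Reasoning
  f″ = f ∘ suc ∘ suc
  shift : ∀ i → suc i ℕ.+ suc i ≡ suc (suc (i ℕ.+ i))
  shift i = ≡.cong suc (ℕ.+-suc i i)
  applyUpTo-cong : ∀ {g h} → (∀ i → g i ≡ h i) → ∀ n → applyUpTo g n ≡ applyUpTo h n
  applyUpTo-cong g≡h zero    = ≡.refl
  applyUpTo-cong g≡h (suc n) = ≡.cong₂ _∷_ (g≡h 0) (applyUpTo-cong (g≡h ∘ suc) n)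

2∣n+n : ∀ n → 2 ℕ.∣ n ℕ.+ n
2∣n+n n = divides n (≡.trans (≡.cong (n ℕ.+_) (≡.sym (ℕ.+-identityʳ n))) (ℕ.*-comm 2 n))

∣odd⇒coprime-2 : ∀ {d} i → d ℕ.∣ suc (i ℕ.+ i) → Coprime d 2
∣odd⇒coprime-2 i d∣ {e} (e∣d , e∣2) = ℕ.∣1⇒≡1 (ℕ.∣m+n∣m⇒∣n
  (≡.subst (e ℕ.∣_) (ℕ.+-comm 1 (i ℕ.+ i)) (ℕ.∣-trans e∣d d∣)) (ℕ.∣-trans e∣2 (2∣n+n i)))

-- The gcd divides an odd number, so it is coprime to 2, and the factors of 2ᵏ can be stripped one
-- at a time until it divides 1.
gcd-odd-2^ : ∀ k i → gcd (suc (i ℕ.+ i)) (2 ℕ.^ k) ≡ 1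
gcd-odd-2^ k i = ∣2^⇒≡1 k (gcd[m,n]∣n (suc (i ℕ.+ i)) (2 ℕ.^ k))
  where
  d = gcd (suc (i ℕ.+ i)) (2 ℕ.^ k)
  ∣2^⇒≡1 : ∀ l → d ℕ.∣ 2 ℕ.^ l → d ≡ 1
  ∣2^⇒≡1 zero    d∣ = ℕ.∣1⇒≡1 d∣
  ∣2^⇒≡1 (suc l) d∣ = ∣2^⇒≡1 l (coprime-divisor (∣odd⇒coprime-2 i (gcd[m,n]∣m (suc (i ℕ.+ i)) (2 ℕ.^ k))) d∣)

coprimes-2^ : ∀ k → coprimes (2 ℕ.^ suc k) ≡ applyUpTo (λ i → suc (i ℕ.+ i)) (2 ℕ.^ k)
coprimes-2^ k = begin
  filter coprime? (map suc (upTo (2 ℕ.^ suc k)))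
    ≡⟨ ≡.cong (filter coprime?) (List.map-upTo suc (2 ℕ.^ suc k)) ⟩
  filter coprime? (applyUpTo suc (2 ℕ.^ suc k))
    ≡⟨ ≡.cong (λ m → filter coprime? (applyUpTo suc (N ℕ.+ m))) (ℕ.+-identityʳ N) ⟩
  filter coprime? (applyUpTo suc (N ℕ.+ N))
    -- Counting from 0, position `i + i` of the list holds the odd number `suc (i + i)`, so the even
    -- positions are the ones kept.
    ≡⟨ filter-alternate coprime? suc (gcd-odd-2^ (suc k)) not-coprime N ⟩
  applyUpTo (λ i → suc (i ℕ.+ i)) N               ∎
  where
  open ≡.≡-Reasoning
  N = 2 ℕ.^ k
  coprime? : Decidable (λ j → gcd j (2 ℕ.^ suc k) ≡ 1)
  coprime? j = gcd j (2 ℕ.^ suc k) ℕ.≟ 1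
  not-coprime : ∀ i → ¬ (gcd (suc (suc (i ℕ.+ i))) (2 ℕ.^ suc k) ≡ 1)
  not-coprime i gcd≡1 with ℕ.∣1⇒≡1 (≡.subst (2 ℕ.∣_) gcd≡1 (gcd-greatest
      (≡.subst (2 ℕ.∣_) (≡.cong suc (ℕ.+-suc i i)) (2∣n+n (suc i))) (ℕ.m∣m*n (2 ℕ.^ k))))
  ... | ()

-- Powers under homomorphisms, and power sums with integer values.

open import Data.Nat.Base using (_+_; _*_; _∸_; _^_; _/_)

module _ (A : RawRing c₁ ℓ₁) (R : CommutativeRing c ℓ)
         {f : RawRing.Carrier A → CommutativeRing.Carrier R}
         (f-hom : IsRingHomomorphism A (CommutativeRing.rawRing R) f) where
  open CommutativeRing R using (_≈_; trans; *-congˡ; rawRing)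
  open IsRingHomomorphism f-hom using (*-homo; 1#-homo)
  open RawSemiringDefs (RawRing.rawSemiring A) using () renaming (_^_ to _^ᴬ_)
  open RawSemiringDefs (RawRing.rawSemiring rawRing) using () renaming (_^_ to _↑_)

  ^-hom : ∀ x k → f (x ^ᴬ k) ≈ f x ↑ k
  ^-hom x zero    = 1#-homo
  ^-hom x (suc k) = trans (*-homo x (x ^ᴬ k)) (*-congˡ (^-hom x k))

module Traces (R : CommutativeRing c ℓ) where
  open CommutativeRing R using (Carrier; _≈_; +-cong; *-cong; *-congˡ; -‿cong; setoid; trans)
    renaming (_+_ to _⊕_; _*_ to _⊗_; _-_ to _⊖_; -_ to ⊝_; *-identityʳ to ⊗-identityʳ)
  open IntegerEmbedding R
  open IntegerSolver R using (solve; _:=_; _:+_; _:*_; _:-_; :-_; con)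
  open CommutativeSemiringExp (CommutativeRing.commutativeSemiring R) using () renaming (_^_ to _↑_)
  open ProductsOverRange R using (^-double)
  open ≈-Reasoning setoid
  private
    refl : ∀ {x} → x ≈ x
    refl = CommutativeRing.refl R

  module _ {x y : Carrier} {s t : ℤ} (x+y≈s : x ⊕ y ≈ fromℤ s) (-xy≈t : ⊝ (x ⊗ y) ≈ fromℤ t) where
    fromℤ-norm : ∀ k → fromℤ (norm s t k) ≈ x ↑ (2 ^ k) ⊗ y ↑ (2 ^ k)
    fromℤ-norm zero = begin
      fromℤ (ℤ.- t)           ≈⟨ fromℤ-neg t ⟩
      ⊝ fromℤ t               ≈⟨ -‿cong -xy≈t ⟨
      ⊝ ⊝ (x ⊗ y)             ≈⟨ solve 2 (λ x y → :- (:- (x :* y)) := x :* y) refl x y ⟩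
      x ⊗ y                   ≈⟨ *-cong (⊗-identityʳ x) (⊗-identityʳ y) ⟨
      x ↑ 1 ⊗ y ↑ 1           ∎
    fromℤ-norm (suc k) = begin
      fromℤ (norm s t k ℤ.* norm s t k)          ≈⟨ fromℤ-* (norm s t k) (norm s t k) ⟩
      fromℤ (norm s t k) ⊗ fromℤ (norm s t k)    ≈⟨ *-cong (fromℤ-norm k) (fromℤ-norm k) ⟩
      (X ⊗ Y) ⊗ (X ⊗ Y)
        ≈⟨ solve 2 (λ x y → (x :* y) :* (x :* y) := (x :* x) :* (y :* y)) refl X Y ⟩
      (X ⊗ X) ⊗ (Y ⊗ Y)                          ≈⟨ *-cong (^-double x k) (^-double y k) ⟨
      x ↑ (2 ^ suc k) ⊗ y ↑ (2 ^ suc k)          ∎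
      where
      X = x ↑ (2 ^ k)
      Y = y ↑ (2 ^ k)

    fromℤ-trace : ∀ k → fromℤ (trace s t k) ≈ x ↑ (2 ^ k) ⊕ y ↑ (2 ^ k)
    fromℤ-trace zero = begin
      fromℤ s         ≈⟨ x+y≈s ⟨
      x ⊕ y           ≈⟨ +-cong (⊗-identityʳ x) (⊗-identityʳ y) ⟨
      x ↑ 1 ⊕ y ↑ 1   ∎
    fromℤ-trace (suc k) = begin
      fromℤ (trace s t k ℤ.* trace s t k ℤ.- + 2 ℤ.* norm s t k)
        ≈⟨ trans (fromℤ-+ (trace s t k ℤ.* trace s t k) _)
             (+-cong (fromℤ-* (trace s t k) (trace s t k))
                     (trans (fromℤ-neg (+ 2 ℤ.* norm s t k)) (-‿cong (fromℤ-* (+ 2) (norm s t k))))) ⟩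
      fromℤ (trace s t k) ⊗ fromℤ (trace s t k) ⊖ fromℤ (+ 2) ⊗ fromℤ (norm s t k)
        ≈⟨ +-cong (*-cong (fromℤ-trace k) (fromℤ-trace k)) (-‿cong (*-congˡ (fromℤ-norm k))) ⟩
      (X ⊕ Y) ⊗ (X ⊕ Y) ⊖ fromℤ (+ 2) ⊗ (X ⊗ Y)
        ≈⟨ solve 2 (λ x y → (x :+ y) :* (x :+ y) :- con (+ 2) :* (x :* y) := x :* x :+ y :* y) refl X Y ⟩
      X ⊗ X ⊕ Y ⊗ Y                              ≈⟨ +-cong (^-double x k) (^-double y k) ⟨
      x ↑ (2 ^ suc k) ⊕ y ↑ (2 ^ suc k)          ∎
      where
      X = x ↑ (2 ^ k)
      Y = y ↑ (2 ^ k)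

-- Arithmetic in ℤ[√2] modulo √2.

module RootTwo (R : CommutativeRing c ℓ) (r : CommutativeRing.Carrier R)
  (r²≈2 : CommutativeRing._≈_ R (CommutativeRing._*_ R r r) (IntegerEmbedding.fromℤ R (+ 2))) where
  open CommutativeRing R
    using (Carrier; _≈_; +-cong; *-cong; *-congʳ; -‿cong; +-congˡ; setoid; trans; sym; rawRing; +-identityʳ; zeroˡ)
    renaming (_+_ to _⊕_; _*_ to _⊗_; -_ to ⊝_)
  open IntegerEmbedding R
  open IntegerSolver R using (solve; _:=_; _:+_; _:*_; _:-_; :-_; con)
  open ≈-Reasoning setoid
  private
    refl : ∀ {x} → x ≈ x
    refl = CommutativeRing.refl R

  linear : ℤ → ℤ → Carrier
  linear A B = fromℤ A ⊕ fromℤ B ⊗ r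

  linear-+ : ∀ A B C D → linear A B ⊕ linear C D ≈ linear (A ℤ.+ C) (B ℤ.+ D)
  linear-+ A B C D = begin
    linear A B ⊕ linear C D
      ≈⟨ solve 5 (λ a b c d r → (a :+ b :* r) :+ (c :+ d :* r) := (a :+ c) :+ (b :+ d) :* r)
                                      refl (fromℤ A) (fromℤ B) (fromℤ C) (fromℤ D) r ⟩
    (fromℤ A ⊕ fromℤ C) ⊕ (fromℤ B ⊕ fromℤ D) ⊗ r  ≈⟨ +-cong (fromℤ-+ A C) (*-congʳ (fromℤ-+ B D)) ⟨
    linear (A ℤ.+ C) (B ℤ.+ D)   ∎

  linear-* : ∀ A B C D → linear A B ⊗ linear C D ≈ linear (A ℤ.* C ℤ.+ + 2 ℤ.* (B ℤ.* D)) (A ℤ.* D ℤ.+ B ℤ.* C)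
  linear-* A B C D = begin
    linear A B ⊗ linear C D
      ≈⟨ solve 5 (λ a b c d r → (a :+ b :* r) :* (c :+ d :* r) := (a :* c :+ (r :* r) :* (b :* d)) :+ (a :* d :+ b :* c) :* r)
                                      refl (fromℤ A) (fromℤ B) (fromℤ C) (fromℤ D) r ⟩
    (fromℤ A ⊗ fromℤ C ⊕ (r ⊗ r) ⊗ (fromℤ B ⊗ fromℤ D)) ⊕ (fromℤ A ⊗ fromℤ D ⊕ fromℤ B ⊗ fromℤ C) ⊗ r
      ≈⟨ +-cong (+-cong (fromℤ-* A C) (trans (fromℤ-* (+ 2) (B ℤ.* D)) (*-cong (sym r²≈2) (fromℤ-* B D))))
                (*-congʳ (+-cong (fromℤ-* A D) (fromℤ-* B C))) ⟨
    (fromℤ (A ℤ.* C) ⊕ fromℤ (+ 2 ℤ.* (B ℤ.* D))) ⊕ (fromℤ (A ℤ.* D) ⊕ fromℤ (B ℤ.* C)) ⊗ r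
      ≈⟨ +-cong (fromℤ-+ (A ℤ.* C) _) (*-congʳ (fromℤ-+ (A ℤ.* D) _)) ⟨
    linear (A ℤ.* C ℤ.+ + 2 ℤ.* (B ℤ.* D)) (A ℤ.* D ℤ.+ B ℤ.* C)   ∎

  linear-neg : ∀ A B → ⊝ linear A B ≈ linear (ℤ.- A) (ℤ.- B)
  linear-neg A B = begin
    ⊝ linear A B
      ≈⟨ solve 3 (λ a b r → :- (a :+ b :* r) := :- a :+ (:- b) :* r) refl (fromℤ A) (fromℤ B) r ⟩
    ⊝ fromℤ A ⊕ (⊝ fromℤ B) ⊗ r        ≈⟨ +-cong (fromℤ-neg A) (*-congʳ (fromℤ-neg B)) ⟨
    linear (ℤ.- A) (ℤ.- B)             ∎

  fromℤ≈linear : ∀ A → fromℤ A ≈ linear A (+ 0)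
  fromℤ≈linear A = sym (trans (+-congˡ (zeroˡ r)) (+-identityʳ _))

  -- The graph of the reduction ℤ[r] → ℤ[r]/(r) = ℤ/2.
  infix 4 _≡₂_
  record _≡₂_ (x : Carrier) (z : ℤ) : Set ℓ where
    constructor reduces
    field
      A B k    : ℤ
      x≈linear : x ≈ linear A B
      A≡z+2k   : A ≡ z ℤ.+ + 2 ℤ.* k

  -- Sending A + Br to the parity of A respects products because (Br)(Dr) = 2BD contributes an even
  -- integer.
  ≡₂-compatible : Compatible rawRing ℤ-rawRing _≡₂_
  ≡₂-compatible = record
    { 0~ = reduces (+ 0) (+ 0) (+ 0) (fromℤ≈linear (+ 0)) ≡.refl
    ; 1~ = reduces (+ 1) (+ 0) (+ 0) (trans (sym (+-identityʳ _)) (fromℤ≈linear (+ 1))) ≡.refl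
    ; +~ = λ {x} {z} {y} {w} (reduces A B k x≈ A≡) (reduces C D l y≈ C≡) →
        reduces (A ℤ.+ C) (B ℤ.+ D) (k ℤ.+ l)
          (trans (+-cong x≈ y≈) (linear-+ A B C D))
          (≡.trans (≡.cong₂ ℤ._+_ A≡ C≡) (identity₊ z w k l))
    ; *~ = λ {x} {z} {y} {w} (reduces A B k x≈ A≡) (reduces C D l y≈ C≡) →
        reduces (A ℤ.* C ℤ.+ + 2 ℤ.* (B ℤ.* D)) (A ℤ.* D ℤ.+ B ℤ.* C)
          (k ℤ.* w ℤ.+ z ℤ.* l ℤ.+ + 2 ℤ.* (k ℤ.* l) ℤ.+ B ℤ.* D)
          (trans (*-cong x≈ y≈) (linear-* A B C D))
          (≡.trans (≡.cong₂ (λ a c → a ℤ.* c ℤ.+ + 2 ℤ.* (B ℤ.* D)) A≡ C≡) (identity* z w k l (B ℤ.* D)))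
    ; -~ = λ {x} {z} (reduces A B k x≈ A≡) → reduces (ℤ.- A) (ℤ.- B) (ℤ.- k)
        (trans (-‿cong x≈) (linear-neg A B))
        (≡.trans (≡.cong ℤ.-_ A≡) (identity₋ z k))
    }
    where
    identity₊ : ∀ z w k l → z ℤ.+ + 2 ℤ.* k ℤ.+ (w ℤ.+ + 2 ℤ.* l) ≡ z ℤ.+ w ℤ.+ + 2 ℤ.* (k ℤ.+ l)
    identity₊ = ℤ-Solver.solve-∀
    identity* : ∀ z w k l e → (z ℤ.+ + 2 ℤ.* k) ℤ.* (w ℤ.+ + 2 ℤ.* l) ℤ.+ + 2 ℤ.* e
                            ≡ z ℤ.* w ℤ.+ + 2 ℤ.* (k ℤ.* w ℤ.+ z ℤ.* l ℤ.+ + 2 ℤ.* (k ℤ.* l) ℤ.+ e)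
    identity* = ℤ-Solver.solve-∀
    identity₋ : ∀ z k → ℤ.- (z ℤ.+ + 2 ℤ.* k) ≡ ℤ.- z ℤ.+ + 2 ℤ.* (ℤ.- k)
    identity₋ = ℤ-Solver.solve-∀

  -- (r s′, t′) and (2, -1) agree modulo r.
  eval-odd : ∀ p → Odd (value p (+ 2) -[1+ 0 ]) → ∀ s′ {t′} → Odd t′ →
    ∃₂ λ A B → Odd A × Evaluation.eval rawRing p (r ⊗ fromℤ s′) (fromℤ t′) ≈ linear A B
  eval-odd p (c , c-odd) s′ (l , ≡.refl) =
    let reduces A B k x≈ A≡ = Compatible.eval~ ≡₂-compatible rs′≡₂2 t′≡₂-1 p in
    A , B , (c ℤ.+ k , ≡.trans A≡ (≡.trans (≡.cong (λ x → x ℤ.+ + 2 ℤ.* k) c-odd) (identity c k))) , x≈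
    where
    -- The constant coefficient of rs′ is 0 = 2 + 2·(-1), whence the last witness.
    rs′≡₂2 : r ⊗ fromℤ s′ ≡₂ + 2
    rs′≡₂2 = reduces (+ 0) s′ -[1+ 0 ]
      (solve 2 (λ r s → r :* s := con (+ 0) :+ s :* r) refl r (fromℤ s′)) ≡.refl
    t′≡₂-1 : fromℤ (+ 1 ℤ.+ + 2 ℤ.* l) ≡₂ -[1+ 0 ]
    t′≡₂-1 = reduces _ (+ 0) (l ℤ.+ + 1) (fromℤ≈linear (+ 1 ℤ.+ + 2 ℤ.* l)) (identity′ l)
      where
      identity′ : ∀ l → + 1 ℤ.+ + 2 ℤ.* l ≡ -[1+ 0 ] ℤ.+ + 2 ℤ.* (l ℤ.+ + 1)
      identity′ = ℤ-Solver.solve-∀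
    identity : ∀ c k → + 1 ℤ.+ + 2 ℤ.* c ℤ.+ + 2 ℤ.* k ≡ + 1 ℤ.+ + 2 ℤ.* (c ℤ.+ k)
    identity = ℤ-Solver.solve-∀

-- Rescaling by ρ.

halve : ∀ n → (∃ λ e → n ≡ e + e) ⊎ (∃ λ e → n ≡ suc (e + e))
halve zero = inj₁ (0 , ≡.refl)
halve (suc n) with halve n
... | inj₁ (e , n≡) = inj₂ (e , ≡.cong suc n≡)
... | inj₂ (e , n≡) = inj₁ (suc e , ≡.cong suc (≡.trans n≡ (≡.sym (ℕ.+-suc e e))))

-- Let ρ = 2ᵃ r, so that ρ² = 2ᵇ.  If x, y have sum rs′ and product -t′, then ρx, ρy have
-- sum s and product -t, and Φₙ(ρx, ρy) = ρ^φ(n) Φₙ(x, y).  Here a and b = 2a + 1 stand for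
-- a - 1 and b of the theorem.
module Rescaling
  (K : HeytingField c ℓ₁ ℓ₂) (ω : ℕ → HeytingField.Carrier K)
  (P : ℕ → RawRing.Carrier ℤ[s,t]) (isLucasAtoms : IsLucasAtoms K ω P)
  (R : CommutativeRing c₁ ℓ)
  {ι : HeytingField.Carrier K → CommutativeRing.Carrier R}
  (ι-hom : IsRingHomomorphism (fieldRawRing K) (CommutativeRing.rawRing R) ι)
  (r : CommutativeRing.Carrier R)
  (r²≈2 : CommutativeRing._≈_ R (CommutativeRing._*_ R r r) (IntegerEmbedding.fromℤ R (+ 2))) where
  open CommutativeRing R
    using (Carrier; _≈_; 1#; +-cong; *-cong; *-congˡ; *-congʳ; +-congʳ; setoid; trans; sym; rawRing; *-identityˡ; distribˡ)
    renaming (_+_ to _⊕_; _*_ to _⊗_; -_ to ⊝_; _-_ to _⊖_)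
  open IntegerEmbedding R
  open IntegerSolver R using (solve; _:=_; _:+_; _:*_; _:-_; :-_)
  open RootTwo R r r²≈2
  open CommutativeSemiringExp (CommutativeRing.commutativeSemiring R)
    using (^-homo-*; ^-congˡ; ^-distrib-*) renaming (_^_ to _↑_)
  open LucasAtomValues K ω P isLucasAtoms R ι-hom
  open Evaluation rawRing using (eval)
  open ≈-Reasoning setoid

  module _
    (independent : ∀ X Y Z → fromℤ X ≈ linear Y Z → X ≡ Y × Z ≡ + 0)
    (s′ t′ : ℤ) (t′-odd : Odd t′) (x y : Carrier)
    (x+y≈rs′ : x ⊕ y ≈ r ⊗ fromℤ s′) (-xy≈t′ : ⊝ (x ⊗ y) ≈ fromℤ t′)
    (a : ℕ) where
    private
      b : ℕ
      b = suc (a + a)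

      refl : ∀ {x} → x ≈ x
      refl = CommutativeRing.refl R

      ρ : Carrier
      ρ = fromℤ (2^ a) ⊗ r

      ρ²≈2ᵇ : ρ ⊗ ρ ≈ fromℤ (2^ b)
      ρ²≈2ᵇ = begin
        (fromℤ (2^ a) ⊗ r) ⊗ (fromℤ (2^ a) ⊗ r)
          ≈⟨ solve 2 (λ p r → (p :* r) :* (p :* r) := (r :* r) :* (p :* p)) refl (fromℤ (2^ a)) r ⟩
        (r ⊗ r) ⊗ (fromℤ (2^ a) ⊗ fromℤ (2^ a))          ≈⟨ *-cong r²≈2 (sym (fromℤ-* (2^ a) (2^ a))) ⟩
        fromℤ (+ 2) ⊗ fromℤ (2^ a ℤ.* 2^ a)              ≈⟨ fromℤ-* (+ 2) (2^ a ℤ.* 2^ a) ⟨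
        fromℤ (+ 2 ℤ.* (2^ a ℤ.* 2^ a))                  ≡⟨ ≡.cong (λ p → fromℤ (+ 2 ℤ.* p)) (2^-+ a a) ⟨
        fromℤ (+ 2 ℤ.* 2^ (a + a))                       ≡⟨ ≡.cong fromℤ (2^-+ 1 (a + a)) ⟨
        fromℤ (2^ b)                                     ∎

      ρ-sum : ρ ⊗ x ⊕ ρ ⊗ y ≈ fromℤ (2^ (suc a) ℤ.* s′)
      ρ-sum = begin
        ρ ⊗ x ⊕ ρ ⊗ y                                    ≈⟨ distribˡ ρ x y ⟨
        ρ ⊗ (x ⊕ y)                                      ≈⟨ *-congˡ x+y≈rs′ ⟩
        fromℤ (2^ a) ⊗ r ⊗ (r ⊗ fromℤ s′)
          ≈⟨ solve 3 (λ p r s → p :* r :* (r :* s) := (r :* r) :* p :* s) refl (fromℤ (2^ a)) r (fromℤ s′) ⟩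
        (r ⊗ r) ⊗ fromℤ (2^ a) ⊗ fromℤ s′                ≈⟨ *-congʳ (*-congʳ r²≈2) ⟩
        fromℤ (+ 2) ⊗ fromℤ (2^ a) ⊗ fromℤ s′            ≈⟨ *-congʳ (fromℤ-* (+ 2) (2^ a)) ⟨
        fromℤ (+ 2 ℤ.* 2^ a) ⊗ fromℤ s′                  ≈⟨ fromℤ-* (+ 2 ℤ.* 2^ a) s′ ⟨
        fromℤ (+ 2 ℤ.* 2^ a ℤ.* s′)                      ≡⟨ ≡.cong (λ p → fromℤ (p ℤ.* s′)) (2^-+ 1 a) ⟨
        fromℤ (2^ (suc a) ℤ.* s′)                        ∎

      ρ-product : ⊝ ((ρ ⊗ x) ⊗ (ρ ⊗ y)) ≈ fromℤ (2^ b ℤ.* t′)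
      ρ-product = begin
        ⊝ ((ρ ⊗ x) ⊗ (ρ ⊗ y))
          ≈⟨ solve 3 (λ ρ x y → :- ((ρ :* x) :* (ρ :* y)) := (ρ :* ρ) :* (:- (x :* y))) refl ρ x y ⟩
        (ρ ⊗ ρ) ⊗ (⊝ (x ⊗ y))                            ≈⟨ *-cong ρ²≈2ᵇ -xy≈t′ ⟩
        fromℤ (2^ b) ⊗ fromℤ t′                          ≈⟨ fromℤ-* (2^ b) t′ ⟨
        fromℤ (2^ b ℤ.* t′)                              ∎

      -- Homogeneity is read off the product instead of the coefficients of `P n`: each linear
      -- factor gives one ρ, and `φ n` is by definition the length of `coprimes n`.
      homogeneous : ∀ (z : ℕ → Carrier) js →
        foldr _⊗_ 1# (map (λ j → ρ ⊗ x ⊖ z j ⊗ (ρ ⊗ y)) js) ≈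
        ρ ↑ length js ⊗ foldr _⊗_ 1# (map (λ j → x ⊖ z j ⊗ y) js)
      homogeneous z []       = sym (*-identityˡ 1#)
      homogeneous z (j ∷ js) = trans (*-congˡ (homogeneous z js))
        (solve 6 (λ ρ x y z q f → (ρ :* x :- z :* (ρ :* y)) :* (q :* f) := (ρ :* q) :* ((x :- z :* y) :* f))
          refl ρ x y (z j) (ρ ↑ length js) (foldr _⊗_ 1# (map (λ j → x ⊖ z j ⊗ y) js)))

      fromℤ-2^-power : ∀ e → fromℤ (2^ b) ↑ e ≈ fromℤ (2^ (b * e))
      fromℤ-2^-power zero    = sym (trans
        (CommutativeRing.reflexive R (≡.cong (fromℤ ∘ 2^) (ℕ.*-zeroʳ b))) (CommutativeRing.+-identityʳ R 1#))
      fromℤ-2^-power (suc e) = begin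
        fromℤ (2^ b) ⊗ fromℤ (2^ b) ↑ e                  ≈⟨ *-congˡ (fromℤ-2^-power e) ⟩
        fromℤ (2^ b) ⊗ fromℤ (2^ (b * e))                ≈⟨ fromℤ-* (2^ b) (2^ (b * e)) ⟨
        fromℤ (2^ b ℤ.* 2^ (b * e))                      ≡⟨ ≡.cong fromℤ (2^-+ b (b * e)) ⟨
        fromℤ (2^ (b + b * e))                           ≡⟨ ≡.cong (fromℤ ∘ 2^) (ℕ.*-suc b e) ⟨
        fromℤ (2^ (b * suc e))                           ∎

      ρ-even-power : ∀ e → ρ ↑ (e + e) ≈ fromℤ (2^ (b * e))
      ρ-even-power e = begin
        ρ ↑ (e + e)            ≈⟨ ^-homo-* ρ e e ⟩
        ρ ↑ e ⊗ ρ ↑ e          ≈⟨ ^-distrib-* ρ ρ e ⟨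
        (ρ ⊗ ρ) ↑ e            ≈⟨ ^-congˡ e ρ²≈2ᵇ ⟩
        fromℤ (2^ b) ↑ e       ≈⟨ fromℤ-2^-power e ⟩
        fromℤ (2^ (b * e))     ∎

      even-case : ∀ e A B → ρ ↑ (e + e) ⊗ linear A B ≈ linear (2^ (b * e) ℤ.* A) (2^ (b * e) ℤ.* B)
      even-case e A B = begin
        ρ ↑ (e + e) ⊗ linear A B          ≈⟨ *-congʳ (ρ-even-power e) ⟩
        fromℤ p ⊗ linear A B
          ≈⟨ solve 4 (λ p A B r → p :* (A :+ B :* r) := p :* A :+ p :* B :* r)
               refl (fromℤ p) (fromℤ A) (fromℤ B) r ⟩
        fromℤ p ⊗ fromℤ A ⊕ fromℤ p ⊗ fromℤ B ⊗ r   ≈⟨ +-cong (fromℤ-* p A) (*-congʳ (fromℤ-* p B)) ⟨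
        linear (p ℤ.* A) (p ℤ.* B)        ∎
        where
        p = 2^ (b * e)

      -- The unpaired factor ρ = 2ᵃr exchanges the two coefficients, as r(A + Br) = 2B + Ar; the odd
      -- `A` ends up in the coefficient of r.
      odd-case : ∀ e A B → ρ ↑ suc (e + e) ⊗ linear A B ≈
        linear (2^ a ℤ.* (+ 2 ℤ.* (2^ (b * e) ℤ.* B))) (2^ a ℤ.* (2^ (b * e) ℤ.* A))
      odd-case e A B = begin
        fromℤ q ⊗ r ⊗ ρ ↑ (e + e) ⊗ linear A B   ≈⟨ CommutativeRing.*-assoc R _ _ _ ⟩
        fromℤ q ⊗ r ⊗ (ρ ↑ (e + e) ⊗ linear A B) ≈⟨ *-congˡ (even-case e A B) ⟩
        fromℤ q ⊗ r ⊗ linear A′ B′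
          ≈⟨ solve 4 (λ q A B r → q :* r :* (A :+ B :* r) := q :* ((r :* r) :* B) :+ q :* A :* r)
               refl (fromℤ q) (fromℤ A′) (fromℤ B′) r ⟩
        fromℤ q ⊗ ((r ⊗ r) ⊗ fromℤ B′) ⊕ fromℤ q ⊗ fromℤ A′ ⊗ r
          ≈⟨ +-cong (*-congˡ (trans (*-congʳ r²≈2) (sym (fromℤ-* (+ 2) B′)))) (*-congʳ (sym (fromℤ-* q A′))) ⟩
        fromℤ q ⊗ fromℤ (+ 2 ℤ.* B′) ⊕ fromℤ (q ℤ.* A′) ⊗ r    ≈⟨ +-congʳ (fromℤ-* q (+ 2 ℤ.* B′)) ⟨
        linear (q ℤ.* (+ 2 ℤ.* B′)) (q ℤ.* A′)  ∎
        where
        q = 2^ a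
        A′ = 2^ (b * e) ℤ.* A
        B′ = 2^ (b * e) ℤ.* B

    module _ {n : ℕ} (2≤n : 2 ≤ n) (value-odd : Odd (value (P n) (+ 2) -[1+ 0 ])) where
      private
        N : ℤ
        N = value (P n) (2^ (suc a) ℤ.* s′) (2^ b ℤ.* t′)

        N≈ : ∀ {A B} → eval (P n) (r ⊗ fromℤ s′) (fromℤ t′) ≈ linear A B → fromℤ N ≈ ρ ↑ φ n ⊗ linear A B
        N≈ {A} {B} eval≈ = begin
          fromℤ N                                        ≈⟨ fromℤ-value (P n) _ _ ⟩
          eval (P n) (fromℤ (2^ (suc a) ℤ.* s′)) (fromℤ (2^ b ℤ.* t′))
                                                         ≈⟨ eval≈cyclotomicProduct (ρ ⊗ x) (ρ ⊗ y) ρ-sum ρ-product n 2≤n ⟩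
          cyclotomicProduct n (ρ ⊗ x) (ρ ⊗ y)
            ≈⟨ homogeneous (λ j → ι (RawSemiringDefs._^_ (RawRing.rawSemiring (fieldRawRing K)) (ω n) j)) (coprimes n) ⟩
          ρ ↑ φ n ⊗ cyclotomicProduct n x y
            ≈⟨ *-congˡ (eval≈cyclotomicProduct x y x+y≈rs′ -xy≈t′ n 2≤n) ⟨
          ρ ↑ φ n ⊗ eval (P n) (r ⊗ fromℤ s′) (fromℤ t′) ≈⟨ *-congˡ eval≈ ⟩
          ρ ↑ φ n ⊗ linear A B                           ∎

      -- φ n cannot be odd: the coefficient of r in N would not vanish.
      v₂-value : v₂ N ≡ [ b * (φ n / 2) ]
      v₂-value with eval-odd (P n) value-odd s′ t′-odd | halve (φ n)
      ... | A , B , A-odd , eval≈ | inj₁ (e , φ≡e+e) = ≡.trans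
        (≡.cong v₂ (proj₁ (independent N (2^ (b * e) ℤ.* A) (2^ (b * e) ℤ.* B) (begin
          fromℤ N                  ≈⟨ N≈ {A} {B} eval≈ ⟩
          ρ ↑ φ n ⊗ linear A B     ≡⟨ ≡.cong (λ k → ρ ↑ k ⊗ linear A B) φ≡e+e ⟩
          ρ ↑ (e + e) ⊗ linear A B ≈⟨ even-case e A B ⟩
          _                        ∎))))
        (≡.trans (v₂-2^k*odd (b * e) A-odd) (≡.cong (λ e → [ b * e ]) (≡.sym φ/2≡e)))
        where
        φ/2≡e : φ n / 2 ≡ e
        φ/2≡e = ≡.trans (≡.cong (_/ 2) (≡.trans φ≡e+e (double e))) (ℕ.m*n/n≡m e 2)
          where
          double : ∀ e → e + e ≡ e * 2
          double = ℕ-Solver.solve-∀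
      -- `independent` equates the coefficient of r with 0, of infinite valuation, whereas the
      -- oddness of `A` makes that valuation finite.
      ... | A , B , A-odd , eval≈ | inj₂ (e , φ≡1+e+e) = ⊥-elim (⊤≢[] (≡.trans
        (≡.cong v₂ (≡.sym (proj₂ (independent N (2^ a ℤ.* (+ 2 ℤ.* (2^ (b * e) ℤ.* B))) (2^ a ℤ.* (2^ (b * e) ℤ.* A)) (begin
          fromℤ N                        ≈⟨ N≈ {A} {B} eval≈ ⟩
          ρ ↑ φ n ⊗ linear A B           ≡⟨ ≡.cong (λ k → ρ ↑ k ⊗ linear A B) φ≡1+e+e ⟩
          ρ ↑ suc (e + e) ⊗ linear A B   ≈⟨ odd-case e A B ⟩
          _                              ∎)))))
        (≡.trans (v₂-2^k* a (2^ (b * e) ℤ.* A)) (≡.cong (a +⁺_) (v₂-2^k*odd (b * e) A-odd)))))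
        where
        ⊤≢[] : ∀ {k} → ⊤⁺ ≢ [ k ]
        ⊤≢[] ()

-- Values of the atoms, computed in extensions of `K`.

module _ (K : HeytingField c ℓ₁ ℓ₂) (char0 : CharacteristicZero K)
  (ω : ℕ → HeytingField.Carrier K) (ω-primitive : ∀ n → 1 ≤ n → IsPrimitiveRoot K n (ω n))
  (P : ℕ → RawRing.Carrier ℤ[s,t]) (isLucasAtoms : IsLucasAtoms K ω P) where
  private
    module K = FieldProperties K
    module Kℤ = IntegerEmbedding K.commutativeRing

  -- Both integers are compared in the extension of `K` by the roots of X² - sX - t, where each
  -- equals γ^(2ᵏ) + γ̄^(2ᵏ). The first coordinate brings the equality back to `K`, and
  -- characteristic 0 brings it back to ℤ.
  value-2^ : ∀ k s t → value (P (2 ^ suc k)) s t ≡ trace s t k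
  value-2^ k s t = K.fromℤ-injective char0 _ _
    (KR.trans (proj₁ (embed-fromℤ (value (P n) s t))) (KR.trans (proj₁ value≈trace)
      (KR.sym (proj₁ (embed-fromℤ (trace s t k))))))
    where
    n = 2 ^ suc k
    N = 2 ^ k
    module KR = CommutativeRing K.commutativeRing
    open QuadraticExtension K.commutativeRing (Kℤ.fromℤ s) (Kℤ.fromℤ t)
    module Q = CommutativeRing commutativeRing
    open IntegerEmbedding commutativeRing using (fromℤ)
    open LucasAtomValues K ω P isLucasAtoms commutativeRing embed-isRingHomomorphism
    open ProductsOverRange commutativeRing
    open CommutativeSemiringExp Q.commutativeSemiring using () renaming (_^_ to _↑_)
    module E = IsRingHomomorphism embed-isRingHomomorphism
    open ≈-Reasoning Q.setoid

    embed-fromℤ : ∀ z → embed (Kℤ.fromℤ z) Q.≈ fromℤ z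
    embed-fromℤ z = ↦-elim (Compatible.fromℤ~ (↦-compatible _ commutativeRing embed-isRingHomomorphism) z)

    γ-sum′ : γ Q.+ γ̄ Q.≈ fromℤ s
    γ-sum′ = Q.trans γ-sum (embed-fromℤ s)
    γ-product′ : Q.- (γ Q.* γ̄) Q.≈ fromℤ t
    γ-product′ = Q.trans γ-product (embed-fromℤ t)

    2≤n : 2 ≤ n
    2≤n = ℕ.*-monoʳ-≤ 2 (ℕ.m^n>0 2 k)

    ζ : Q.Carrier
    ζ = embed (ω n)

    ζᴺ≈-1 : ζ ↑ N Q.≈ Q.- Q.1#
    ζᴺ≈-1 = begin
      ζ ↑ N              ≈⟨ ^-hom _ commutativeRing embed-isRingHomomorphism (ω n) N ⟨
      embed _            ≈⟨ E.⟦⟧-cong (PrimitiveRoots.half-power K (ℕ.m^n>0 2 k)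
                              (≡.subst (λ m → IsPrimitiveRoot K m (ω n)) (≡.cong (λ m → N + m) (ℕ.+-identityʳ N))
                                (ω-primitive n (ℕ.≤-trans (s≤s z≤n) 2≤n)))) ⟩
      embed (KR.- KR.1#) ≈⟨ E.-‿homo KR.1# ⟩
      Q.- Q.1#           ∎

    value≈trace : fromℤ (value (P n) s t) Q.≈ fromℤ (trace s t k)
    value≈trace = begin
      fromℤ (value (P n) s t)            ≈⟨ fromℤ-value (P n) s t ⟩
      _                                  ≈⟨ eval≈cyclotomicProduct γ γ̄ γ-sum′ γ-product′ n 2≤n ⟩
      foldr Q._*_ Q.1# (map f (coprimes n))
        ≡⟨ ≡.cong (foldr Q._*_ Q.1#) (≡.trans (≡.cong (map f) (coprimes-2^ k)) (List.map-applyUpTo _ f N)) ⟩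
      ∏ (λ i → f (suc (i + i))) N        ≈⟨ ∏-cong (λ i → Q.+-congˡ {γ} (Q.-‿cong (Q.*-congʳ {γ̄}
                                            (^-hom _ commutativeRing embed-isRingHomomorphism (ω n) (suc (i + i)))))) N ⟩
      ∏ (λ i → γ Q.- ζ ↑ suc (i + i) Q.* γ̄) N ≈⟨ ∏-odd-powers k ζ γ γ̄ ζᴺ≈-1 ⟩
      γ ↑ N Q.+ γ̄ ↑ N                    ≈⟨ Traces.fromℤ-trace commutativeRing γ-sum′ γ-product′ k ⟨
      fromℤ (trace s t k)                ∎
      where
      f : ℕ → Q.Carrier
      f j = γ Q.- embed (RawSemiringDefs._^_ (RawRing.rawSemiring (fieldRawRing K)) (ω n) j) Q.* γ̄

  -- `L` adjoins r = √2 to `K`, and `M` adjoins to `L` two elements with sum rs′ and product -t′.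
  -- The order is forced, as the second quadratic already involves r.
  v₂-value-generic : ∀ {n} → 2 ≤ n → ∀ k m → n ≡ 2 ^ k * m → ¬ (2 ℕ.∣ m) → 1 < m →
    ∀ a s′ {t′} → Odd t′ →
    v₂ (value (P n) (2^ (suc a) ℤ.* s′) (2^ (suc (a + a)) ℤ.* t′)) ≡ [ suc (a + a) * (φ n / 2) ]
  v₂-value-generic {n} 2≤n k m n≡ 2∤m 1<m a s′ {t′} t′-odd =
    Rescaling.v₂-value K ω P isLucasAtoms M.commutativeRing ι-hom r r²≈2 independent s′ t′ t′-odd M.γ M.γ̄
      (Q.trans M.γ-sum (Q.trans (ML.*-homo L.γ (Lℤ.fromℤ s′)) (Q.*-congˡ {r} (embed-fromℤ s′))))
      (Q.trans M.γ-product (embed-fromℤ t′))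
      a 2≤n
      (PrimitiveRoots.value-2,-1-odd K char0 ω P isLucasAtoms
        (ω-primitive n (ℕ.≤-trans (s≤s z≤n) 2≤n)) 2≤n {q = 2 ^ k} n≡ 1<m (2∤⇒odd 2∤m))
    where
    module KR = CommutativeRing K.commutativeRing
    module L = QuadraticExtension K.commutativeRing KR.0# (Kℤ.fromℤ (+ 2))
    module LR = CommutativeRing L.commutativeRing
    module Lℤ = IntegerEmbedding L.commutativeRing
    module M = QuadraticExtension L.commutativeRing (L.γ LR.* Lℤ.fromℤ s′) (Lℤ.fromℤ t′)
    module Q = CommutativeRing M.commutativeRing
    module Mℤ = IntegerEmbedding M.commutativeRing
    module ML = IsRingHomomorphism M.embed-isRingHomomorphism

    ι-hom : IsRingHomomorphism KR.rawRing Q.rawRing (M.embed ∘ L.embed)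
    ι-hom = isRingHomomorphism Q.trans L.embed-isRingHomomorphism M.embed-isRingHomomorphism

    L-embed-fromℤ : ∀ z → L.embed (Kℤ.fromℤ z) LR.≈ Lℤ.fromℤ z
    L-embed-fromℤ z = ↦-elim (Compatible.fromℤ~ (↦-compatible _ L.commutativeRing L.embed-isRingHomomorphism) z)

    embed-fromℤ : ∀ z → M.embed (Lℤ.fromℤ z) Q.≈ Mℤ.fromℤ z
    embed-fromℤ z = ↦-elim (Compatible.fromℤ~ (↦-compatible _ M.commutativeRing M.embed-isRingHomomorphism) z)

    r : Q.Carrier
    r = M.embed L.γ

    r²≈2 : r Q.* r Q.≈ Mℤ.fromℤ (+ 2)
    r²≈2 = Q.trans (Q.sym (ML.*-homo L.γ L.γ))
      (Q.trans (ML.⟦⟧-cong (LR.trans L.γ-square (L-embed-fromℤ (+ 2)))) (embed-fromℤ (+ 2)))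

    -- All elements involved come from `L`, so first coordinates in `M` suffice; coordinates in `L`
    -- then separate 1 from r, and characteristic 0 passes from `K` to ℤ.
    independent : ∀ X Y Z → Mℤ.fromℤ X Q.≈ Mℤ.fromℤ Y Q.+ Mℤ.fromℤ Z Q.* r → X ≡ Y × Z ≡ + 0
    independent X Y Z eq =
      let X≈ , Z≈0 = L.independent (LR.trans (L-embed-fromℤ X) (LR.trans (proj₁ eq′)
                       (LR.sym (LR.+-cong (L-embed-fromℤ Y) (LR.*-congʳ {L.γ} (L-embed-fromℤ Z))))))
      in K.fromℤ-injective char0 X Y X≈ , K.fromℤ-nonzero char0 Z Z≈0
      where
      eq′ : M.embed (Lℤ.fromℤ X) Q.≈ M.embed (Lℤ.fromℤ Y LR.+ Lℤ.fromℤ Z LR.* L.γ)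
      eq′ = Q.trans (embed-fromℤ X) (Q.trans eq (Q.sym (Q.trans
        (ML.+-homo (Lℤ.fromℤ Y) (Lℤ.fromℤ Z LR.* L.γ))
        (Q.+-cong (embed-fromℤ Y) (Q.trans (ML.*-homo (Lℤ.fromℤ Z) L.γ) (Q.*-congʳ {r} (embed-fromℤ Z)))))))

-- The valuation formula, case by case.

open import Data.Integer.Divisibility using (_∣_)

theorem19 : ∀ {c ℓ₁ ℓ₂} (K : HeytingField c ℓ₁ ℓ₂) → CharacteristicZero K →
    (ω : ℕ → HeytingField.Carrier K) →
    (∀ n → 1 ≤ n → IsPrimitiveRoot K n (ω n)) →
    (P : ℕ → RawRing.Carrier ℤ[s,t]) → IsLucasAtoms K ω P →
    (s t s′ t′ : ℤ) (a b : ℕ) → 0 < a → 0 < b →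
    s ≡ + (2 ^ a) ℤ.* s′ → t ≡ + (2 ^ b) ℤ.* t′ →
    ¬ (+ 2 ∣ s′ ℤ.* t′) → b ≡ 2 * a ∸ 1 →
    (n : ℕ) → 2 ≤ n →
    (n ≡ 2 → v₂ (value (P n) s t) ≡ [ a ])
    × (n ≡ 4 → v₂ (value (P n) s t) ≡ (b + 1) +⁺ v₂ (s′ ℤ.* s′ ℤ.+ t′))
    × ((h : ℕ) → 3 ≤ h → n ≡ 2 ^ h → v₂ (value (P n) s t) ≡ [ 2 ^ (h ∸ 2) * b + 1 ])
    × (n ≢ 2 → n ≢ 4 → ((h : ℕ) → 3 ≤ h → n ≢ 2 ^ h) →
    v₂ (value (P n) s t) ≡ [ b * (φ n / 2) ])
theorem19 K char0 ω ω-primitive P isLucasAtoms _ _ s′ t′ a@(suc a₀) b _ _ ≡.refl ≡.refl 2∤s′t′ b≡2a-1 n 2≤n =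
  case₂ , case₄ , case-2^ , otherwise
  where
  -- The relation b = 2a - 1 is freed from truncated subtraction in two ways: this form, in a₀ = a -
  -- 1, matches ρ = 2^(a-1)r, while `a+a≡b+1` balances s² against 2t.
  b≡ : b ≡ suc (a₀ + a₀)
  b≡ = ≡.trans b≡2a-1 (≡.trans (ℕ.+-suc a₀ (a₀ + 0)) (≡.cong (λ m → suc (a₀ + m)) (ℕ.+-identityʳ a₀)))

  a+a≡b+1 : a + a ≡ b + 1
  a+a≡b+1 = ≡.trans (≡.cong suc (ℕ.+-suc a₀ a₀)) (≡.trans (≡.cong suc (≡.sym b≡)) (ℕ.+-comm 1 b))

  s′-odd : Odd s′
  s′-odd = 2∤⇒odd λ 2∣s′ → 2∤s′t′ (≡.subst (2 ℕ.∣_) (≡.sym (ℤ.abs-* s′ t′)) (ℕ.∣m⇒∣m*n ℤ.∣ t′ ∣ 2∣s′))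

  t′-odd : Odd t′
  t′-odd = 2∤⇒odd λ 2∣t′ → 2∤s′t′ (≡.subst (2 ℕ.∣_) (≡.sym (ℤ.abs-* s′ t′)) (ℕ.∣n⇒∣m*n ℤ.∣ s′ ∣ 2∣t′))

  open TraceValuation s′ t′ t′-odd a b a+a≡b+1

  atom-2^ : ∀ k → n ≡ 2 ^ suc k → value (P n) s t ≡ trace s t k
  atom-2^ k ≡.refl = value-2^ K char0 ω ω-primitive P isLucasAtoms k s t

  case₂ : n ≡ 2 → v₂ (value (P n) s t) ≡ [ a ]
  case₂ n≡2 = ≡.trans (≡.cong v₂ (atom-2^ 0 n≡2)) (v₂-2^k*odd a s′-odd)

  case₄ : n ≡ 4 → v₂ (value (P n) s t) ≡ (b + 1) +⁺ v₂ (s′ ℤ.* s′ ℤ.+ t′)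
  case₄ n≡4 = ≡.trans (≡.cong v₂ (≡.trans (atom-2^ 1 n≡4) trace-1)) (v₂-2^k* (b + 1) (s′ ℤ.* s′ ℤ.+ t′))

  case-2^ : (h : ℕ) → 3 ≤ h → n ≡ 2 ^ h → v₂ (value (P n) s t) ≡ [ 2 ^ (h ∸ 2) * b + 1 ]
  case-2^ (suc (suc (suc k))) (s≤s (s≤s (s≤s z≤n))) n≡2^h =
    -- Here n = 2ᵏ⁺³, so the atom is the trace of index k + 2, and h - 2 = k + 1.
    let o , o-odd , trace≡ = trace-form k in
    ≡.trans (≡.cong v₂ (≡.trans (atom-2^ (suc (suc k)) n≡2^h) trace≡)) (v₂-2^k*odd (2 ^ suc k * b + 1) o-odd)

  -- The odd part of `n` decides. If it is 1, then `n` is a power of 2, ruled out by 2 ≤ n for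
  -- exponent 0 and by the three exclusions for the others; if not, it is the odd divisor greater
  -- than 1 that the generic case asks for.
  otherwise : n ≢ 2 → n ≢ 4 → ((h : ℕ) → 3 ≤ h → n ≢ 2 ^ h) → v₂ (value (P n) s t) ≡ [ b * (φ n / 2) ]
  otherwise n≢2 n≢4 n≢2^h with odd-part n (ℕ.≤-trans (s≤s z≤n) 2≤n)
  ... | k , 0 , _ , 2∤0 = ⊥-elim (2∤0 (ℕ.divides 0 ≡.refl))
  ... | k , 1 , n≡ , _ = ⊥-elim (not-2^ k (≡.trans n≡ (ℕ.*-identityʳ (2 ^ k))))
    where
    not-2^ : ∀ k → n ≢ 2 ^ k
    not-2^ 0 n≡1 = ℕ.<⇒≢ 2≤n (≡.sym n≡1)
    not-2^ 1 = n≢2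
    not-2^ 2 = n≢4
    not-2^ h@(suc (suc (suc _))) = n≢2^h h (s≤s (s≤s (s≤s z≤n)))
  ... | k , m@(suc (suc _)) , n≡ , 2∤m = ≡.subst
    (λ b → v₂ (value (P n) s (2^ b ℤ.* t′)) ≡ [ b * (φ n / 2) ]) (≡.sym b≡)
    (v₂-value-generic K char0 ω ω-primitive P isLucasAtoms 2≤n k m n≡ 2∤m (s≤s (s≤s z≤n)) a₀ s′ t′-odd)
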